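{- Let $S$ be the vertex set of an acute $0/1$-simplex in $[0,1]^n$ with $k\leq n$ vertices, and let $m\geq1$. Regard $[0,1]^n$ as the facet of $[0,1]^{n+m}$ consisting of points whose last $m$ coordinates vanish, so that $S$ is also the vertex set of an acute $0/1$-simplex in $[0,1]^{n+m}$. Then $$\mathcal{C}^{n+m}(S)=\left\{\begin{bmatrix}v\\ w\end{bmatrix}: v\in\mathcal{C}^n(S),\ w\in\{0,1\}^m\right\},\qquad \mathcal{A}^{n+m}(S)\supseteq\left\{\begin{bmatrix}v\\ w\end{bmatrix}: v\in\mathcal{A}^n(S),\ w\in\{0,1\}^m\right\}.$$ Moreover, for each $v\in\mathcal{C}^n(S)$ there exists an integer $\ell$ such that, for $w\in\{0,1\}^m$ (with $m$ large enough), $w^\top w\geq\ell$ if and only if $\begin{bmatrix}v\\ w\end{bmatrix}\in\mathcal{A}^{n+m}(S)$.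
   Context: A set of $j+1$ affinely independent points $a_0,\dots,a_j\in\{0,1\}^N$ is the vertex set of an acute $0/1$-$j$-simplex if all dihedral angles of their convex hull are acute; equivalently, with $P=[a_1-a_0,\dots,a_j-a_0]$ and $G=P^\top P$, every off-diagonal entry of $G^{ -1}$ is negative and every row sum of $G^{ -1}$ is positive. For the vertex set $S\subseteq\{0,1\}^N$ of an acute $0/1$-simplex: the set of acute extensions $\mathcal{A}^N(S)$ consists of all $v\in\{0,1\}^N$ such that $S\cup\{v\}$ is the vertex set of an acute $0/1$-simplex with one more vertex; the set of candidate acute extensions $\mathcal{C}^N(S)$ consists of all $v\in\{0,1\}^N$ whose orthogonal projection onto the affine hull of $S$ lies in the (relative) interior of the convex hull of $S$. -}

module Defs where

open import Algebra.Properties.CommutativeMonoid.Sum using (sum)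
open import Data.Bool using (Bool; true; false; if_then_else_)
open import Data.Fin using (Fin; zero; suc; _≟_)
open import Data.Nat using (ℕ; zero; suc) renaming (_+_ to _+ℕ_)
open import Data.Product using (∃; ∃-syntax; ∃₂; _×_)
open import Data.Rational using (ℚ; 0ℚ; 1ℚ; _+_; _*_; _-_; _≤_; _<_)
open import Data.Rational.Properties using (+-0-commutativeMonoid)
open import Data.Vec using (Vec; lookup; replicate; _++_)
open import Level using (0ℓ)
open import Relation.Binary.PropositionalEquality using (_≡_; _≢_; _≗_)
open import Relation.Nullary.Decidable using (⌊_⌋)
open import Relation.Unary using (Pred; _∈_; _∪_; ｛_｝; _≐_)

-- All vectors and matrices below are rational.  Vertices of the cube are
-- rational points, so inverse Gram matrices, barycentric coordinates and
-- orthogonal projections of such points onto affine hulls of such points are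
-- rational too, and nothing is lost by working over ℚ instead of ℝ.

ℚ^ : ℕ → Set
ℚ^ N = Fin N → ℚ

Σℚ : ∀ {k} → (Fin k → ℚ) → ℚ
Σℚ = sum +-0-commutativeMonoid

infixl 7 _·_
infixl 6 _−_

_−_ : ∀ {N} → ℚ^ N → ℚ^ N → ℚ^ N
(x − y) i = x i - y i

_·_ : ∀ {N} → ℚ^ N → ℚ^ N → ℚ
x · y = Σℚ λ i → x i * y i

lin : ∀ {N k} → (Fin k → ℚ) → (Fin k → ℚ^ N) → ℚ^ N
lin c x i = Σℚ λ l → c l * x l i

Cube : ℕ → Set
Cube N = Vec Bool N

ι : ∀ {N} → Cube N → ℚ^ N
ι v i = if lookup v i then 1ℚ else 0ℚ

------------------------------------------------------------------------
-- Matrices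

Matrix : ℕ → ℕ → Set
Matrix r c = Fin r → Fin c → ℚ

_ᵀ : ∀ {r c} → Matrix r c → Matrix c r
(A ᵀ) i k = A k i

infixl 7 _⊛_

_⊛_ : ∀ {r s c} → Matrix r s → Matrix s c → Matrix r c
(A ⊛ B) i k = Σℚ λ l → A i l * B l k

𝟙 : ∀ {r} → Matrix r r
𝟙 i k = if ⌊ i ≟ k ⌋ then 1ℚ else 0ℚ

IsInverse : ∀ {r} → Matrix r r → Matrix r r → Set
IsInverse A B = (∀ i k → (A ⊛ B) i k ≡ 𝟙 i k) × (∀ i k → (B ⊛ A) i k ≡ 𝟙 i k)

------------------------------------------------------------------------
-- Acute simplices

AffinelyIndependent : ∀ {N k} → (Fin k → ℚ^ N) → Set
AffinelyIndependent a = ∀ c → Σℚ c ≡ 0ℚ → (∀ i → lin c a i ≡ 0ℚ) → ∀ l → c l ≡ 0ℚ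

-- The matrix P with columns a₁ − a₀ , … , aⱼ − a₀.
edges : ∀ {N j} → (Fin (suc j) → ℚ^ N) → Matrix N j
edges a i l = (a (suc l) − a zero) i

gram : ∀ {N j} → (Fin (suc j) → ℚ^ N) → Matrix j j
gram a = edges a ᵀ ⊛ edges a

-- All dihedral angles of the simplex with vertices a₀ , … , aⱼ are acute,
-- expressed through the inverse H of the Gram matrix PᵀP.
HasAcuteAngles : ∀ {N j} → (Fin (suc j) → ℚ^ N) → Set
HasAcuteAngles {_} {j} a = ∃ λ (H : Matrix j j) →
  IsInverse (gram a) H ×
  (∀ i k → i ≢ k → H i k < 0ℚ) ×
  (∀ i → 0ℚ < Σℚ (H i))

-- S is the vertex set of an acute 0/1-j-simplex (so S has j + 1 elements).
IsAcuteSimplex : ∀ {N} → ℕ → Pred (Cube N) 0ℓ → Set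
IsAcuteSimplex {N} j S = ∃ λ (a : Fin (suc j) → Cube N) →
  (S ≐ λ x → ∃[ i ] a i ≡ x) ×
  AffinelyIndependent (λ i → ι (a i)) ×
  HasAcuteAngles (λ i → ι (a i))

𝒜 : ∀ {N} → Pred (Cube N) 0ℓ → Pred (Cube N) 0ℓ
𝒜 S v = ∃[ j ] IsAcuteSimplex j S × IsAcuteSimplex (suc j) (S ∪ ｛ v ｝)

------------------------------------------------------------------------
-- Hulls, relative interior, orthogonal projection

AffineHull : ∀ {N} → Pred (ℚ^ N) 0ℓ → Pred (ℚ^ N) 0ℓ
AffineHull {N} X y = ∃ λ k → ∃₂ λ (x : Fin k → ℚ^ N) (c : Fin k → ℚ) →
  (∀ i → x i ∈ X) × Σℚ c ≡ 1ℚ × y ≗ lin c x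

ConvexHull : ∀ {N} → Pred (ℚ^ N) 0ℓ → Pred (ℚ^ N) 0ℓ
ConvexHull {N} X y = ∃ λ k → ∃₂ λ (x : Fin k → ℚ^ N) (c : Fin k → ℚ) →
  (∀ i → x i ∈ X) × (∀ i → 0ℚ ≤ c i) × Σℚ c ≡ 1ℚ × y ≗ lin c x

RelativeInterior : ∀ {N} → Pred (ℚ^ N) 0ℓ → Pred (ℚ^ N) 0ℓ
RelativeInterior X p = p ∈ X × ∃ λ ε → 0ℚ < ε ×
  (∀ y → y ∈ AffineHull X → (y − p) · (y − p) < ε * ε → y ∈ X)

-- p is the orthogonal projection of x onto the affine subspace T.
IsOrthogonalProjection : ∀ {N} → Pred (ℚ^ N) 0ℓ → ℚ^ N → ℚ^ N → Set
IsOrthogonalProjection T x p = p ∈ T × (∀ q → q ∈ T → (x − p) · (q − p) ≡ 0ℚ)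

points : ∀ {N} → Pred (Cube N) 0ℓ → Pred (ℚ^ N) 0ℓ
points S x = ∃[ s ] s ∈ S × x ≗ ι s

𝒞 : ∀ {N} → Pred (Cube N) 0ℓ → Pred (Cube N) 0ℓ
𝒞 S v = ∃[ p ] IsOrthogonalProjection (AffineHull (points S)) (ι v) p ×
               p ∈ RelativeInterior (ConvexHull (points S))

------------------------------------------------------------------------
-- Passing from the n-cube to the (n + m)-cube

-- S as a subset of the facet whose last m coordinates vanish.
embed : ∀ {n} m → Pred (Cube n) 0ℓ → Pred (Cube (n +ℕ m)) 0ℓ
embed m S x = ∃[ s ] s ∈ S × x ≡ s ++ replicate m false

-- { [v ; w] : v ∈ X , w ∈ {0,1}ᵐ }
cylinder : ∀ {n} m → Pred (Cube n) 0ℓ → Pred (Cube (n +ℕ m)) 0ℓ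
cylinder {n} m X x = ∃₂ λ (v : Cube n) (w : Cube m) → v ∈ X × x ≡ v ++ w

-- Write an acute simplex through its barycentric coordinates, coordᵢ x = qᵢ · x + κᵢ, where the
-- dual vectors qᵢ = Σₘ Lᵢₘ aₘ have Gram matrix L.  Acuteness says that the off-diagonal entries of
-- L are negative, a condition symmetric in the vertices.  For any x, the numbers βᵢ = coordᵢ x are
-- the barycentric coordinates of the orthogonal projection of x, so x is a candidate iff all βᵢ are
-- positive.  Adding x, at squared distance η from the affine hull, changes the entries to
-- Lᵢₘ + βᵢ βₘ / η and borders them by − βᵢ / η and 1 / η; hence x is an acute extension iff η > 0,
-- all βᵢ > 0 and Lᵢₘ η + βᵢ βₘ < 0 for i ≢ m.  Passing from v to [v ; w] keeps L and β and adds w · w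
-- to η, so the last condition is monotone in w · w and holds as soon as w · w is large.
module Submission where

open import Defs
open import Algebra.Bundles using (CommutativeRing)
open import Data.Bool using (true; false)
open import Data.Fin using (Fin; zero; suc; _≟_)
open import Data.Fin.Permutation using (Permutation; permutation; ↔⇒≡; _⟨$⟩ʳ_; _⟨$⟩ˡ_; inverseˡ) renaming (id to idₚ)
open import Data.Fin.Properties using (all?)
open import Data.Integer using (ℤ)
import Data.Integer as ℤ
import Data.Integer.Properties as ℤₚ
open import Data.Maybe using (Maybe; just; nothing)
open import Data.Nat using (ℕ; zero; suc; _≤_; z≤n; s≤s; _⊔_)
import Data.Nat as ℕ
import Data.Nat.Coprimality as Coprimality
import Data.Nat.Properties as ℕₚ
open import Data.Product using (∃; ∃-syntax; _×_; _,_; proj₁; proj₂; map₂)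
open import Data.Rational using (ℚ; mkℚ; 0ℚ; 1ℚ; _+_; _*_; _-_; -_; 1/_; _<_; _/_; *≤*; positive; negative; nonNegative; nonPositive; >-nonZero) renaming (_≤_ to _≤ℚ_)
open import Data.Rational.Properties renaming (_≟_ to _≟ℚ_)
open import Data.Sum using (inj₁; inj₂)
open import Data.Vec using ([]; _∷_; _++_; replicate; splitAt)
open import Data.Vec.Properties using (lookup-replicate)
open import Function using (_∘_)
open import Function.Bundles using (_⇔_; mk⇔; module Equivalence)
open import Level using (0ℓ)
open import Relation.Binary.Definitions using (tri<; tri≈; tri>)
open import Relation.Binary.PropositionalEquality
open import Relation.Nullary using (Dec; yes; no; contradiction)
open import Relation.Nullary.Decidable using (map′; _×-dec_; _→-dec_; ¬?)
open import Relation.Unary using (Pred; _∈_; _∉_; _⊆_; _⊇_; _≐_; _∪_; ｛_｝)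
open import Tactic.RingSolver using (solve-∀)
open import Tactic.RingSolver.Core.AlmostCommutativeRing using (AlmostCommutativeRing; fromCommutativeRing)
import Algebra.Properties.Semiring.Sum (CommutativeRing.semiring +-*-commutativeRing) as Sum

-- `HasAcuteAngles` singles out one vertex, whereas `𝒜` supplies enumerations of S and of S with v
-- added in unrelated orders; hence the bordered matrix L, whose rows sum to zero and which can be
-- permuted freely. Everything is phrased through inner products, so one reindexing lemma serves
-- both for a change of order and for the passage to a larger cube. Neither determinants nor
-- uniqueness of inverses enter: pairing the dual vectors of two simplices in two ways
-- (`coord-exchange`) gives the symmetry of L and relates the L of a simplex to that of its
-- extension. Square roots are avoided by expanding squares, which keeps every step in ℚ.
-- Comparisons there are decidable, and this makes ℓ an explicit least number.

-- Finite sums over ℚ and the identity matrix.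

ℚ-zero? : (x : ℚ) → Maybe (0ℚ ≡ x)
ℚ-zero? x with 0ℚ ≟ℚ x
... | yes p = just p
... | no _ = nothing

ℚ-ring : AlmostCommutativeRing 0ℓ 0ℓ
ℚ-ring = fromCommutativeRing +-*-commutativeRing ℚ-zero?

Σ-cong : ∀ {k} {f g : Fin k → ℚ} → (∀ i → f i ≡ g i) → Σℚ f ≡ Σℚ g
Σ-cong = Sum.sum-cong-≗

Σ-*ˡ : ∀ {k} x (f : Fin k → ℚ) → x * Σℚ f ≡ Σℚ (λ i → x * f i)
Σ-*ˡ = Sum.*-distribˡ-sum

Σ-*ʳ : ∀ {k} (f : Fin k → ℚ) x → Σℚ f * x ≡ Σℚ (λ i → f i * x)
Σ-*ʳ f x = Sum.*-distribʳ-sum x f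

Σ-+ : ∀ {k} (f g : Fin k → ℚ) → Σℚ (λ i → f i + g i) ≡ Σℚ f + Σℚ g
Σ-+ = Sum.∑-distrib-+

Σ-zero : ∀ {k} {f : Fin k → ℚ} → (∀ i → f i ≡ 0ℚ) → Σℚ f ≡ 0ℚ
Σ-zero {k} z = trans (Σ-cong z) (Sum.sum-replicate-zero k)

Σ-neg : ∀ {k} (f : Fin k → ℚ) → Σℚ (λ i → - f i) ≡ - Σℚ f
Σ-neg f = begin
  Σℚ (λ i → - f i)        ≡⟨ Σ-cong (λ i → neg≡ (f i)) ⟩
  Σℚ (λ i → - 1ℚ * f i)   ≡⟨ Σ-*ˡ (- 1ℚ) f ⟨
  - 1ℚ * Σℚ f             ≡⟨ neg≡ (Σℚ f) ⟨
  - Σℚ f                  ∎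
  where
  open ≡-Reasoning
  neg≡ : ∀ x → - x ≡ - 1ℚ * x
  neg≡ = solve-∀ ℚ-ring

Σ-- : ∀ {k} (f g : Fin k → ℚ) → Σℚ (λ i → f i - g i) ≡ Σℚ f - Σℚ g
Σ-- f g = trans (Σ-+ f (λ i → - g i)) (cong (Σℚ f +_) (Σ-neg g))

-- The bilinear form of `g` at `c` and `d`, summed in either order. The weights stay outside, so
-- that each inner sum can be recognised as an inner product or a coordinate.
Σ-swap : ∀ {k l} (c : Fin k → ℚ) (d : Fin l → ℚ) (g : Fin k → Fin l → ℚ) →
  Σℚ (λ i → c i * Σℚ (λ m → d m * g i m)) ≡ Σℚ (λ m → d m * Σℚ (λ i → c i * g i m))
Σ-swap {k} {l} c d g = begin
  Σℚ (λ i → c i * Σℚ (λ m → d m * g i m))    ≡⟨ Σ-cong (λ i → Σ-*ˡ {l} (c i) _) ⟩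
  Σℚ (λ i → Σℚ (λ m → c i * (d m * g i m)))  ≡⟨ Sum.∑-comm (λ i m → c i * (d m * g i m)) ⟩
  Σℚ (λ m → Σℚ (λ i → c i * (d m * g i m)))  ≡⟨ Σ-cong (λ m → Σ-cong (λ i → exchange (c i) (d m) (g i m))) ⟩
  Σℚ (λ m → Σℚ (λ i → d m * (c i * g i m)))  ≡⟨ Σ-cong (λ m → Σ-*ˡ {k} (d m) _) ⟨
  Σℚ (λ m → d m * Σℚ (λ i → c i * g i m))    ∎
  where
  open ≡-Reasoning
  exchange : ∀ x y z → x * (y * z) ≡ y * (x * z)
  exchange = solve-∀ ℚ-ring

Σ-shift : ∀ {k} (c f : Fin k → ℚ) x → Σℚ (λ i → c i * (f i + x)) ≡ Σℚ (λ i → c i * f i) + Σℚ c * x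
Σ-shift {k} c f x = begin
  Σℚ (λ i → c i * (f i + x))                ≡⟨ Σ-cong (λ i → *-distribˡ-+ (c i) (f i) x) ⟩
  Σℚ (λ i → c i * f i + c i * x)            ≡⟨ Σ-+ {k} _ _ ⟩
  Σℚ (λ i → c i * f i) + Σℚ (λ i → c i * x) ≡⟨ cong (Σℚ (λ i → c i * f i) +_) (Σ-*ʳ c x) ⟨
  Σℚ (λ i → c i * f i) + Σℚ c * x           ∎
  where open ≡-Reasoning

-- Used with a row of L as `c`: under such a row a constant like κ may be added or dropped.
Σ-shift₀ : ∀ {k} (c f : Fin k → ℚ) x → Σℚ c ≡ 0ℚ → Σℚ (λ i → c i * (f i + x)) ≡ Σℚ (λ i → c i * f i)
Σ-shift₀ c f x c≡0 = begin
  Σℚ (λ i → c i * (f i + x))      ≡⟨ Σ-shift c f x ⟩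
  Σℚ (λ i → c i * f i) + Σℚ c * x ≡⟨ cong (λ s → Σℚ (λ i → c i * f i) + s * x) c≡0 ⟩
  Σℚ (λ i → c i * f i) + 0ℚ * x   ≡⟨ lemma (Σℚ (λ i → c i * f i)) x ⟩
  Σℚ (λ i → c i * f i)            ∎
  where
  open ≡-Reasoning
  lemma : ∀ s x → s + 0ℚ * x ≡ s
  lemma = solve-∀ ℚ-ring

Σ-const : ∀ {k} (c : Fin k → ℚ) {f : Fin k → ℚ} {x} → (∀ i → f i ≡ x) → Σℚ (λ i → c i * f i) ≡ Σℚ c * x
Σ-const c {f} {x} fx = trans (Σ-cong (λ i → cong (c i *_) (fx i))) (sym (Σ-*ʳ c x))

𝟙-diag : ∀ {k} (i : Fin k) → 𝟙 i i ≡ 1ℚ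
𝟙-diag i with i ≟ i
... | yes _ = refl
... | no ¬p = contradiction refl ¬p

𝟙-off : ∀ {k} {i l : Fin k} → i ≢ l → 𝟙 i l ≡ 0ℚ
𝟙-off {i = i} {l} i≢l with i ≟ l
... | yes p = contradiction p i≢l
... | no _ = refl

𝟙-suc : ∀ {k} (i l : Fin k) → 𝟙 (suc i) (suc l) ≡ 𝟙 i l
𝟙-suc i l with i ≟ l
... | yes _ = refl
... | no _ = refl

𝟙-comm : ∀ {k} (i l : Fin k) → 𝟙 i l ≡ 𝟙 l i
𝟙-comm zero zero = refl
𝟙-comm zero (suc l) = refl
𝟙-comm (suc i) zero = refl
𝟙-comm (suc i) (suc l) = trans (𝟙-suc i l) (trans (𝟙-comm i l) (sym (𝟙-suc l i)))

Σ-𝟙ʳ : ∀ {k} (c : Fin k → ℚ) i → Σℚ (λ l → c l * 𝟙 l i) ≡ c i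
Σ-𝟙ʳ {suc k} c zero = begin
  c zero * 1ℚ + Σℚ (λ l → c (suc l) * 0ℚ) ≡⟨ cong₂ _+_ (*-identityʳ (c zero)) (Σ-zero (λ l → *-zeroʳ (c (suc l)))) ⟩
  c zero + 0ℚ                             ≡⟨ +-identityʳ (c zero) ⟩
  c zero                                  ∎
  where open ≡-Reasoning
Σ-𝟙ʳ {suc k} c (suc i) = begin
  c zero * 0ℚ + Σℚ (λ l → c (suc l) * 𝟙 (suc l) (suc i)) ≡⟨ cong₂ _+_ (*-zeroʳ (c zero)) (Σ-cong (λ l → cong (c (suc l) *_) (𝟙-suc l i))) ⟩
  0ℚ + Σℚ (λ l → c (suc l) * 𝟙 l i) ≡⟨ cong (0ℚ +_) (Σ-𝟙ʳ (c ∘ suc) i) ⟩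
  0ℚ + c (suc i)                             ≡⟨ +-identityˡ _ ⟩
  c (suc i)                                  ∎
  where open ≡-Reasoning

Σ-𝟙ˡ : ∀ {k} (c : Fin k → ℚ) i → Σℚ (λ l → c l * 𝟙 i l) ≡ c i
Σ-𝟙ˡ c i = trans (Σ-cong (λ l → cong (c l *_) (𝟙-comm i l))) (Σ-𝟙ʳ c i)

-- Inner products and signs.

·-cong : ∀ {N} {x x′ y y′ : ℚ^ N} → x ≗ x′ → y ≗ y′ → x · y ≡ x′ · y′
·-cong p q = Σ-cong (λ i → cong₂ _*_ (p i) (q i))

·-comm : ∀ {N} (x y : ℚ^ N) → x · y ≡ y · x
·-comm x y = Σ-cong (λ i → *-comm (x i) (y i))

·-lin : ∀ {N k} (x : ℚ^ N) (c : Fin k → ℚ) (a : Fin k → ℚ^ N) → x · lin c a ≡ Σℚ (λ l → c l * (x · a l))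
·-lin x c a = Σ-swap x c (λ i l → a l i)

·-−ʳ : ∀ {N} (x y z : ℚ^ N) → x · (y − z) ≡ x · y - x · z
·-−ʳ {N} x y z = trans (Σ-cong (λ i → lemma (x i) (y i) (z i))) (Σ-- {N} _ _)
  where
  lemma : ∀ x y z → x * (y - z) ≡ x * y - x * z
  lemma = solve-∀ ℚ-ring

·-−ˡ : ∀ {N} (x y z : ℚ^ N) → (x − y) · z ≡ x · z - y · z
·-−ˡ x y z = trans (·-comm (x − y) z) (trans (·-−ʳ z x y) (cong₂ _-_ (·-comm z x) (·-comm z y)))

Σ-nonneg : ∀ {k} {f : Fin k → ℚ} → (∀ i → 0ℚ ≤ℚ f i) → 0ℚ ≤ℚ Σℚ f
Σ-nonneg {zero} _ = ≤-refl
Σ-nonneg {suc k} p = +-mono-≤ (p zero) (Σ-nonneg (p ∘ suc))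

*-pos : ∀ {p q} → 0ℚ < p → 0ℚ < q → 0ℚ < p * q
*-pos {p} {q} 0<p 0<q = positive⁻¹ _ {{pos*pos⇒pos p {{positive 0<p}} q {{positive 0<q}}}}

*-nonneg : ∀ {p q} → 0ℚ ≤ℚ p → 0ℚ ≤ℚ q → 0ℚ ≤ℚ p * q
*-nonneg {p} {q} 0≤p 0≤q = nonNegative⁻¹ _ {{nonNeg*nonNeg⇒nonNeg p {{nonNegative 0≤p}} q {{nonNegative 0≤q}}}}

square-nonneg : ∀ p → 0ℚ ≤ℚ p * p
square-nonneg p with ≤-total 0ℚ p
... | inj₁ 0≤p = *-nonneg 0≤p 0≤p
... | inj₂ p≤0 = nonNegative⁻¹ _ {{nonPos*nonPos⇒nonPos p {{nonPositive p≤0}} p {{nonPositive p≤0}}}}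

·-nonneg : ∀ {N} (x : ℚ^ N) → 0ℚ ≤ℚ x · x
·-nonneg x = Σ-nonneg (λ i → square-nonneg (x i))

*-neg-pos : ∀ {p q} → p < 0ℚ → 0ℚ < q → p * q < 0ℚ
*-neg-pos {p} {q} p<0 0<q = negative⁻¹ _ {{neg*pos⇒neg p {{negative p<0}} q {{positive 0<q}}}}

*-cancel-pos : ∀ {p q} → 0ℚ < q → 0ℚ < p * q → 0ℚ < p
*-cancel-pos {p} {q} 0<q 0<pq =
  *-cancelʳ-<-nonNeg q {{nonNegative (<⇒≤ 0<q)}} (subst (_< p * q) (sym (*-zeroˡ q)) 0<pq)

*-cancel-neg : ∀ {p q} → 0ℚ < q → p * q < 0ℚ → p < 0ℚ
*-cancel-neg {p} {q} 0<q pq<0 =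
  *-cancelʳ-<-nonNeg q {{nonNegative (<⇒≤ 0<q)}} (subst (p * q <_) (sym (*-zeroˡ q)) pq<0)

inverse : ∀ {p} → 0ℚ < p → ∃ λ r → 0ℚ < r × r * p ≡ 1ℚ
inverse {p} 0<p = (1/ p) {{nz}} , positive⁻¹ _ {{1/pos⇒pos p {{positive 0<p}}}} , *-inverseˡ p {{nz}}
  where nz = >-nonZero 0<p

-- Barycentric coordinates, feet and heights.

-- κ makes the i-th row of L into an affine function, the i-th barycentric coordinate.  Only inner
-- products of the vertices occur, and no vertex is distinguished, unlike in HasAcuteAngles.
record Acute {N k} (a : Fin k → ℚ^ N) : Set where
  field
    L        : Matrix k k
    κ        : Fin k → ℚ
    L-rowsum : ∀ i → Σℚ (L i) ≡ 0ℚ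
    dual     : ∀ i l → Σℚ (λ m → L i m * (a m · a l)) + κ i ≡ 𝟙 i l
    L-neg    : ∀ i m → i ≢ m → L i m < 0ℚ

  coord : Fin k → ℚ^ N → ℚ
  coord i x = Σℚ (λ m → L i m * (a m · x)) + κ i

  foot height : ℚ^ N → ℚ^ N
  foot x = lin (λ i → coord i x) a
  height x = x − foot x

  η : ℚ^ N → ℚ
  η x = height x · height x

  coord-cong : ∀ i {x y} → x ≗ y → coord i x ≡ coord i y
  coord-cong i x≗y = cong (_+ κ i) (Σ-cong (λ m → cong (L i m *_) (·-cong {x = a m} (λ _ → refl) x≗y)))

  -- Only the constant κ i feels the sum of the weights: it is multiplied by Σ c, so it survives
  -- intact for affine combinations.
  coord-lin : ∀ {l} i (c : Fin l → ℚ) (x : Fin l → ℚ^ N) → Σℚ c ≡ 1ℚ →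
    coord i (lin c x) ≡ Σℚ (λ t → c t * coord i (x t))
  coord-lin i c x Σc≡1 = begin
    Σℚ (λ m → L i m * (a m · lin c x)) + κ i
      ≡⟨ cong (_+ κ i) (Σ-cong (λ m → cong (L i m *_) (·-lin (a m) c x))) ⟩
    Σℚ (λ m → L i m * Σℚ (λ t → c t * (a m · x t))) + κ i
      ≡⟨ cong (_+ κ i) (Σ-swap (L i) c (λ m t → a m · x t)) ⟩
    Σℚ (λ t → c t * Σℚ (λ m → L i m * (a m · x t))) + κ i
      ≡⟨ cong (Σℚ (λ t → c t * Σℚ (λ m → L i m * (a m · x t))) +_)
           (trans (cong (_* κ i) Σc≡1) (*-identityˡ (κ i))) ⟨
    Σℚ (λ t → c t * Σℚ (λ m → L i m * (a m · x t))) + Σℚ c * κ i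
      ≡⟨ Σ-shift c (λ t → Σℚ (λ m → L i m * (a m · x t))) (κ i) ⟨
    Σℚ (λ t → c t * coord i (x t)) ∎
    where open ≡-Reasoning

  coord-lin-vertices : ∀ i c → Σℚ c ≡ 1ℚ → coord i (lin c a) ≡ c i
  coord-lin-vertices i c Σc≡1 =
    trans (coord-lin i c a Σc≡1) (trans (Σ-cong (λ l → cong (c l *_) (dual i l))) (Σ-𝟙ˡ c i))

  -- `coord i` is 1 at its own vertex and 0 at all others, so it separates them.
  vertex-injective : ∀ {i l} → a i ≗ a l → i ≡ l
  vertex-injective {i} {l} ai≗al with i ≟ l
  ... | yes i≡l = i≡l
  ... | no i≢l = contradiction 1≡0 1≢0
    where
    1≡0 : 1ℚ ≡ 0ℚ
    1≡0 = begin
      1ℚ            ≡⟨ 𝟙-diag i ⟨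
      𝟙 i i         ≡⟨ dual i i ⟨
      coord i (a i) ≡⟨ coord-cong i ai≗al ⟩
      coord i (a l) ≡⟨ dual i l ⟩
      𝟙 i l         ≡⟨ 𝟙-off i≢l ⟩
      0ℚ            ∎
      where open ≡-Reasoning

module _ {N k l} {a : Fin k → ℚ^ N} {b : Fin l → ℚ^ N} (A : Acute a) (B : Acute b) where
  private
    module A = Acute A
    module B = Acute B

  -- Both sides are the inner product of the i-th dual vector of `a` with the m-th dual vector of
  -- `b`; the constants drop out because rows of L sum to zero. With A = B this is the symmetry of
  -- L.
  coord-exchange : ∀ i m → Σℚ (λ t → A.L i t * B.coord m (a t)) ≡ Σℚ (λ t → B.L m t * A.coord i (b t))
  coord-exchange i m = begin
    Σℚ (λ t → A.L i t * B.coord m (a t))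
      ≡⟨ Σ-shift₀ (A.L i) (λ t → Σℚ (λ s → B.L m s * (b s · a t))) (B.κ m) (A.L-rowsum i) ⟩
    Σℚ (λ t → A.L i t * Σℚ (λ s → B.L m s * (b s · a t)))
      ≡⟨ Σ-swap (A.L i) (B.L m) (λ t s → b s · a t) ⟩
    Σℚ (λ s → B.L m s * Σℚ (λ t → A.L i t * (b s · a t)))
      ≡⟨ Σ-cong (λ s → cong (B.L m s *_) (Σ-cong (λ t → cong (A.L i t *_) (·-comm (b s) (a t))))) ⟩
    Σℚ (λ s → B.L m s * Σℚ (λ t → A.L i t * (a t · b s)))
      ≡⟨ Σ-shift₀ (B.L m) (λ s → Σℚ (λ t → A.L i t * (a t · b s))) (A.κ i) (B.L-rowsum m) ⟨
    Σℚ (λ t → B.L m t * A.coord i (b t)) ∎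
    where open ≡-Reasoning

module _ {N j} {a : Fin (suc j) → ℚ^ N} (A : Acute a) where
  open Acute A

  Σ-L-𝟙 : ∀ i m → Σℚ (λ t → L i t * coord m (a t)) ≡ L i m
  Σ-L-𝟙 i m = trans (Σ-cong (λ t → cong (L i t *_) (dual m t))) (Σ-𝟙ˡ (L i) m)

  L-sym : ∀ i m → L i m ≡ L m i
  L-sym i m = trans (sym (Σ-L-𝟙 i m)) (trans (coord-exchange A A i m) (Σ-L-𝟙 m i))

  -- By symmetry the columns of L sum to zero too, so the sum does not depend on the point; it is
  -- evaluated at the vertex `a zero`.
  coord-sum : ∀ x → Σℚ (λ i → coord i x) ≡ 1ℚ
  coord-sum x = trans (step x) (trans (sym (step (a zero))) (trans
    (Σ-cong (λ i → trans (dual i zero) (sym (*-identityˡ (𝟙 i zero)))))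
    (Σ-𝟙ʳ {suc j} (λ _ → 1ℚ) zero)))
    where
    open ≡-Reasoning
    step : ∀ y → Σℚ (λ i → coord i y) ≡ Σℚ κ
    step y = begin
      Σℚ (λ i → coord i y)
        ≡⟨ Σ-+ (λ i → Σℚ (λ m → L i m * (a m · y))) κ ⟩
      Σℚ (λ i → Σℚ (λ m → L i m * (a m · y))) + Σℚ κ
        ≡⟨ cong (_+ Σℚ κ) (Sum.∑-comm (λ i m → L i m * (a m · y))) ⟩
      Σℚ (λ m → Σℚ (λ i → L i m * (a m · y))) + Σℚ κ
        ≡⟨ cong (_+ Σℚ κ) (Σ-zero column) ⟩
      0ℚ + Σℚ κ
        ≡⟨ +-identityˡ (Σℚ κ) ⟩
      Σℚ κ ∎
      where
      column : ∀ m → Σℚ (λ i → L i m * (a m · y)) ≡ 0ℚ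
      column m = begin
        Σℚ (λ i → L i m * (a m · y)) ≡⟨ Σ-*ʳ (λ i → L i m) (a m · y) ⟨
        Σℚ (λ i → L i m) * (a m · y) ≡⟨ cong (_* (a m · y)) (trans (Σ-cong (λ i → L-sym i m)) (L-rowsum m)) ⟩
        0ℚ * (a m · y)               ≡⟨ *-zeroˡ (a m · y) ⟩
        0ℚ                           ∎

  foot-vertex : ∀ l → foot (a l) ≗ a l
  foot-vertex l t = trans (Σ-cong (λ i → trans (cong (_* a i t) (dual i l)) (*-comm (𝟙 i l) (a i t)))) (Σ-𝟙ʳ (λ i → a i t) l)

  private
    -- Since `coord m` takes the value κ m at the origin, this is the inner product of x with the
    -- foot of the origin.
    q : ℚ^ N → ℚ
    q x = Σℚ (λ m → (a m · x) * κ m)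

  -- By `dual`, L times the Gram matrix of the vertices is the identity minus κ repeated in every
  -- column. This collapses the quadratic term of the expansion to a l · x - q x, and the κ part is
  -- q (a l).
  foot-dot : ∀ l x → a l · foot x ≡ a l · x - q x + q (a l)
  foot-dot l x = begin
    a l · foot x
      ≡⟨ ·-lin (a l) (λ i → coord i x) a ⟩
    Σℚ (λ i → coord i x * (a l · a i))
      ≡⟨ Σ-cong (λ i → expand (Σℚ (λ m → L i m * (a m · x))) (κ i) (a l · a i)) ⟩
    Σℚ (λ i → (a l · a i) * Σℚ (λ m → L i m * (a m · x)) + (a l · a i) * κ i)
      ≡⟨ Σ-+ (λ i → (a l · a i) * Σℚ (λ m → L i m * (a m · x))) (λ i → (a l · a i) * κ i) ⟩
    Σℚ (λ i → (a l · a i) * Σℚ (λ m → L i m * (a m · x))) + Σℚ (λ i → (a l · a i) * κ i)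
      ≡⟨ cong₂ _+_ quadratic (Σ-cong (λ i → cong (_* κ i) (·-comm (a l) (a i)))) ⟩
    a l · x - q x + q (a l) ∎
    where
    open ≡-Reasoning
    expand : ∀ s t u → (s + t) * u ≡ u * s + u * t
    expand = solve-∀ ℚ-ring
    isolate : ∀ s t {u} → s + t ≡ u → s ≡ u - t
    isolate s t refl = lemma s t
      where
      lemma : ∀ s t → s ≡ s + t - t
      lemma = solve-∀ ℚ-ring
    distrib : ∀ s t u → s * (t - u) ≡ s * t - s * u
    distrib = solve-∀ ℚ-ring
    quadratic : Σℚ (λ i → (a l · a i) * Σℚ (λ m → L i m * (a m · x))) ≡ a l · x - q x
    quadratic = begin
      Σℚ (λ i → (a l · a i) * Σℚ (λ m → L i m * (a m · x)))
        ≡⟨ Σ-cong (λ i → cong ((a l · a i) *_) (Σ-cong (λ m → *-comm (L i m) (a m · x)))) ⟩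
      Σℚ (λ i → (a l · a i) * Σℚ (λ m → (a m · x) * L i m))
        ≡⟨ Σ-swap (λ i → a l · a i) (λ m → a m · x) L ⟩
      Σℚ (λ m → (a m · x) * Σℚ (λ i → (a l · a i) * L i m))
        ≡⟨ Σ-cong (λ m → cong ((a m · x) *_) (Σ-cong (λ i →
             trans (cong₂ _*_ (·-comm (a l) (a i)) (L-sym i m)) (*-comm (a i · a l) (L m i))))) ⟩
      Σℚ (λ m → (a m · x) * Σℚ (λ i → L m i * (a i · a l)))
        ≡⟨ Σ-cong (λ m → trans
             (cong ((a m · x) *_) (isolate (Σℚ (λ i → L m i * (a i · a l))) (κ m) (dual m l)))
             (distrib (a m · x) (𝟙 m l) (κ m))) ⟩
      Σℚ (λ m → (a m · x) * 𝟙 m l - (a m · x) * κ m)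
        ≡⟨ Σ-- (λ m → (a m · x) * 𝟙 m l) (λ m → (a m · x) * κ m) ⟩
      Σℚ (λ m → (a m · x) * 𝟙 m l) - q x
        ≡⟨ cong (_- q x) (Σ-𝟙ʳ (λ m → a m · x) l) ⟩
      a l · x - q x ∎

  private
    -- `foot-dot` at `a zero`, a point fixed by `foot`: the two equal inner products cancel.
    q-vertex : ∀ l → q (a l) ≡ q (a zero)
    q-vertex l = lemma (trans (sym (·-cong {x = a l} (λ _ → refl) (foot-vertex zero))) (foot-dot l (a zero)))
      where
      cancel : ∀ s t u → s - (s - u + t) + t ≡ u
      cancel = solve-∀ ℚ-ring
      cancel′ : ∀ s t → s - s + t ≡ t
      cancel′ = solve-∀ ℚ-ring
      lemma : ∀ {s t u} → s ≡ s - u + t → t ≡ u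
      lemma {s} {t} {u} eq = trans (sym (cancel′ s t)) (trans (cong (λ z → s - z + t) eq) (cancel s t u))

  -- The common inner product of `height x` with all points of the affine hull. The height is
  -- orthogonal to differences of such points, but the hull may miss the origin, so the value need
  -- not vanish.
  γ : ℚ^ N → ℚ
  γ x = q x - q (a zero)

  height-vertex : ∀ x l → height x · a l ≡ γ x
  height-vertex x l = begin
    height x · a l                               ≡⟨ ·-−ˡ x (foot x) (a l) ⟩
    x · a l - foot x · a l                       ≡⟨ cong₂ _-_ (·-comm x (a l)) (·-comm (foot x) (a l)) ⟩
    a l · x - a l · foot x                       ≡⟨ cong (λ z → a l · x - z) (foot-dot l x) ⟩
    a l · x - (a l · x - q x + q (a l))          ≡⟨ lemma (a l · x) (q x) (q (a l)) ⟩
    q x - q (a l)                                ≡⟨ cong (λ z → q x - z) (q-vertex l) ⟩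
    γ x                                          ∎
    where
    open ≡-Reasoning
    lemma : ∀ s t u → s - (s - t + u) ≡ t - u
    lemma = solve-∀ ℚ-ring

  height-lin : ∀ x c → height x · lin c a ≡ Σℚ c * γ x
  height-lin x c = trans (·-lin (height x) c a) (Σ-const c (height-vertex x))

  height-affine : ∀ x c → Σℚ c ≡ 1ℚ → height x · lin c a ≡ γ x
  height-affine x c Σc≡1 = trans (height-lin x c) (trans (cong (_* γ x) Σc≡1) (*-identityˡ (γ x)))

  height-foot : ∀ x → height x · foot x ≡ γ x
  height-foot x = height-affine x (λ i → coord i x) (coord-sum x)

  height-self : ∀ x → height x · x ≡ η x + γ x
  height-self x = begin
    height x · x                                                  ≡⟨ lemma (height x · x) (height x · foot x) ⟩
    height x · x - height x · foot x + height x · foot x          ≡⟨ cong₂ _+_ (sym (·-−ʳ (height x) x (foot x))) (height-foot x) ⟩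
    η x + γ x                                                     ∎
    where
    open ≡-Reasoning
    lemma : ∀ s t → s ≡ s - t + t
    lemma = solve-∀ ℚ-ring

  coord-foot : ∀ i x → coord i (foot x) ≡ coord i x
  coord-foot i x = coord-lin-vertices i (λ m → coord m x) (coord-sum x)

-- Positive rationals and small radii.

<⇒0<- : ∀ {p q} → p < q → 0ℚ < q - p
<⇒0<- {p} {q} p<q = subst (_< q - p) (+-inverseʳ p) (+-monoˡ-< (- p) p<q)

≤⇒0≤- : ∀ {p q} → p ≤ℚ q → 0ℚ ≤ℚ q - p
≤⇒0≤- {p} {q} p≤q = subst (_≤ℚ q - p) (+-inverseʳ p) (+-monoˡ-≤ (- p) p≤q)

0<-⇒< : ∀ {p q} → 0ℚ < q - p → p < q
0<-⇒< {p} {q} 0<q-p = subst₂ _<_ (+-identityˡ p) (lemma p q) (+-monoˡ-< p 0<q-p)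
  where
  lemma : ∀ p q → q - p + p ≡ q
  lemma = solve-∀ ℚ-ring

0<1 : 0ℚ < 1ℚ
0<1 = positive⁻¹ 1ℚ

0<1+ : ∀ {p} → 0ℚ ≤ℚ p → 0ℚ < 1ℚ + p
0<1+ 0≤p = +-mono-<-≤ 0<1 0≤p

𝟙-nonneg : ∀ {k} (i l : Fin k) → 0ℚ ≤ℚ 𝟙 i l
𝟙-nonneg i l with i ≟ l
... | yes _ = <⇒≤ 0<1
... | no _ = ≤-refl

cancel-inverse : ∀ β {s r} → s * r ≡ 1ℚ → β * s * r ≡ β
cancel-inverse β {s} {r} sr≡1 = trans (*-assoc β s r) (trans (cong (β *_) sr≡1) (*-identityʳ β))

-- A stand-in for the minimum of the quotients β i / r i, capped at 1 so that the empty family has a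
-- value.
common-scale : ∀ {k} (r β : Fin k → ℚ) → (∀ i → 0ℚ < r i) → (∀ i → 0ℚ < β i) →
  ∃ λ ε → 0ℚ < ε × (∀ i → ε * r i ≤ℚ β i)
common-scale {zero} r β 0<r 0<β = 1ℚ , 0<1 , λ ()
common-scale {suc k} r β 0<r 0<β
  with common-scale (r ∘ suc) (β ∘ suc) (0<r ∘ suc) (0<β ∘ suc) | inverse (0<r zero)
... | ε , 0<ε , tail | s , 0<s , sr≡1 with ≤-total ε (β zero * s)
... | inj₁ ε≤ = ε , 0<ε , λ where
  zero    → ≤-trans (*-monoʳ-≤-nonNeg (r zero) {{nonNegative (<⇒≤ (0<r zero))}} ε≤) (≤-reflexive (cancel-inverse (β zero) sr≡1))
  (suc i) → tail i
... | inj₂ ≤ε = β zero * s , *-pos (0<β zero) 0<s , λ where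
  zero    → ≤-reflexive (cancel-inverse (β zero) sr≡1)
  (suc i) → ≤-trans (*-monoʳ-≤-nonNeg (r (suc i)) {{nonNegative (<⇒≤ (0<r (suc i)))}} ≤ε) (tail i)

·-expand : ∀ {N} e (x y : ℚ^ N) →
  (λ t → e * x t + y t) · (λ t → e * x t + y t) ≡ e * e * (x · x) + (e + e) * (x · y) + y · y
·-expand e x y = begin
  Σℚ (λ t → (e * x t + y t) * (e * x t + y t))
    ≡⟨ Σ-cong (λ t → lemma e (x t) (y t)) ⟩
  Σℚ (λ t → e * e * (x t * x t) + (e + e) * (x t * y t) + y t * y t)
    ≡⟨ Σ-+ (λ t → e * e * (x t * x t) + (e + e) * (x t * y t)) (λ t → y t * y t) ⟩
  Σℚ (λ t → e * e * (x t * x t) + (e + e) * (x t * y t)) + y · y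
    ≡⟨ cong (_+ y · y) (Σ-+ (λ t → e * e * (x t * x t)) (λ t → (e + e) * (x t * y t))) ⟩
  Σℚ (λ t → e * e * (x t * x t)) + Σℚ (λ t → (e + e) * (x t * y t)) + y · y
    ≡⟨ cong (_+ y · y) (cong₂ _+_ (Σ-*ˡ (e * e) (λ t → x t * x t)) (Σ-*ˡ (e + e) (λ t → x t * y t))) ⟨
  e * e * (x · x) + (e + e) * (x · y) + y · y ∎
  where
  open ≡-Reasoning
  lemma : ∀ e s t → (e * s + t) * (e * s + t) ≡ e * e * (s * s) + (e + e) * (s * t) + t * t
  lemma = solve-∀ ℚ-ring

pair : ∀ {a} {A : Set a} → A → A → Fin 2 → A
pair x y zero = x
pair x y (suc _) = y

-- Candidates: hulls, projections and relative interior.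

module _ {N j} {a : Fin (suc j) → ℚ^ N} (A : Acute a) where
  open Acute A

  -- The dual vector qᵢ of the overview, which is the gradient of `coord i`.
  normal : Fin (suc j) → ℚ^ N
  normal i = lin (L i) a

  ·-normal : ∀ x i → x · normal i ≡ Σℚ (λ m → L i m * (a m · x))
  ·-normal x i = trans (·-lin x (L i) a) (Σ-cong (λ m → cong (L i m *_) (·-comm x (a m))))

  coord-difference : ∀ i x y → coord i x ≡ coord i y + (x − y) · normal i
  coord-difference i x y = begin
    coord i x                                    ≡⟨ cong (_+ κ i) (·-normal x i) ⟨
    x · normal i + κ i                           ≡⟨ lemma (x · normal i) (y · normal i) (κ i) ⟩
    y · normal i + κ i + (x · normal i - y · normal i)
      ≡⟨ cong₂ _+_ (cong (_+ κ i) (·-normal y i)) (sym (·-−ˡ x y (normal i))) ⟩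
    coord i y + (x − y) · normal i               ∎
    where
    open ≡-Reasoning
    lemma : ∀ s t u → s + u ≡ t + u + (s - t)
    lemma = solve-∀ ℚ-ring

  foot-cong : ∀ {x y} → x ≗ y → foot x ≗ foot y
  foot-cong x≗y t = Σ-cong (λ i → cong (_* a i t) (coord-cong i x≗y))

  -- `foot` is an affine map, so its fixed points are closed under affine combinations. `P` is left
  -- general because it is needed both for the vertices and for their convex hull.
  foot-AffineHull : ∀ {P : Pred (ℚ^ N) 0ℓ} → (∀ {x} → x ∈ P → foot x ≗ x) → ∀ {y} → y ∈ AffineHull P → foot y ≗ y
  foot-AffineHull fixed {y} (k , x , c , x∈P , Σc≡1 , y≗) t = begin
    foot y t
      ≡⟨ foot-cong y≗ t ⟩
    Σℚ (λ i → coord i (lin c x) * a i t)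
      ≡⟨ Σ-cong (λ i → trans (cong (_* a i t) (coord-lin i c x Σc≡1)) (*-comm (Σℚ (λ l → c l * coord i (x l))) (a i t))) ⟩
    Σℚ (λ i → a i t * Σℚ (λ l → c l * coord i (x l)))
      ≡⟨ Σ-swap (λ i → a i t) c (λ i l → coord i (x l)) ⟩
    Σℚ (λ l → c l * Σℚ (λ i → a i t * coord i (x l)))
      ≡⟨ Σ-cong (λ l → cong (c l *_) (trans (Σ-cong (λ i → *-comm (a i t) (coord i (x l)))) (fixed (x∈P l) t))) ⟩
    lin c x t
      ≡⟨ y≗ t ⟨
    y t ∎
    where open ≡-Reasoning

module _ {N j} {S : Pred (Cube N) 0ℓ} {a : Fin (suc j) → Cube N}
         (S≐a : S ≐ λ x → ∃[ i ] a i ≡ x) (A : Acute (λ i → ι (a i))) where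
  open Acute A

  private
    Hull : Pred (ℚ^ N) 0ℓ
    Hull = ConvexHull (points S)

  vertex-point : ∀ i → ι (a i) ∈ points S
  vertex-point i = a i , proj₂ S≐a (i , refl) , λ _ → refl

  point-vertex : ∀ {x} → x ∈ points S → ∃ λ i → x ≗ ι (a i)
  point-vertex (s , s∈S , x≗) with proj₁ S≐a s∈S
  ... | i , refl = i , x≗

  foot-point : ∀ {x} → x ∈ points S → foot x ≗ x
  foot-point x∈ t with point-vertex x∈
  ... | l , x≗ = trans (foot-cong A x≗ t) (trans (foot-vertex A l t) (sym (x≗ t)))

  foot-Hull : ∀ {y} → y ∈ Hull → foot y ≗ y
  foot-Hull (k , x , c , x∈ , _ , Σc≡1 , y≗) = foot-AffineHull A foot-point (k , x , c , x∈ , Σc≡1 , y≗)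

  coord-Hull : ∀ i {y} → y ∈ Hull → 0ℚ ≤ℚ coord i y
  coord-Hull i (k , x , c , x∈ , 0≤c , Σc≡1 , y≗) =
    subst (0ℚ ≤ℚ_) (sym (trans (coord-cong i y≗) (coord-lin i c x Σc≡1))) (Σ-nonneg (λ l → *-nonneg (0≤c l) (nonneg l)))
    where
    nonneg : ∀ l → 0ℚ ≤ℚ coord i (x l)
    nonneg l with point-vertex (x∈ l)
    ... | m , x≗ = subst (0ℚ ≤ℚ_) (sym (trans (coord-cong i x≗) (dual i m))) (𝟙-nonneg i m)

  coord-nonneg⇒Hull : ∀ {y} → foot y ≗ y → (∀ i → 0ℚ ≤ℚ coord i y) → y ∈ Hull
  coord-nonneg⇒Hull {y} fixed 0≤ =
    suc j , (λ i → ι (a i)) , (λ i → coord i y) , vertex-point , 0≤ , coord-sum A y , λ t → sym (fixed t)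

  height-AffineHull : ∀ x {y} → y ∈ AffineHull (points S) → height x · y ≡ γ A x
  height-AffineHull x {y} (k , p , c , p∈ , Σc≡1 , y≗) = begin
    height x · y        ≡⟨ ·-cong {x = height x} (λ _ → refl) y≗ ⟩
    height x · lin c p  ≡⟨ ·-lin (height x) c p ⟩
    Σℚ (λ l → c l * (height x · p l)) ≡⟨ Σ-const c at-point ⟩
    Σℚ c * γ A x        ≡⟨ cong (_* γ A x) Σc≡1 ⟩
    1ℚ * γ A x          ≡⟨ *-identityˡ (γ A x) ⟩
    γ A x               ∎
    where
    open ≡-Reasoning
    at-point : ∀ l → height x · p l ≡ γ A x
    at-point l with point-vertex (p∈ l)
    ... | m , p≗ = trans (·-cong {x = height x} (λ _ → refl) p≗) (height-vertex A x m)

  -- x - p has the same inner product with every vertex, and a row of L annihilates constants, so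
  -- the change of `coord i` from p to x is zero.
  coord-projection : ∀ {x p} → IsOrthogonalProjection (AffineHull (points S)) x p → ∀ i → coord i x ≡ coord i p
  coord-projection {x} {p} (p∈ , orthogonal) i = begin
    coord i x                          ≡⟨ coord-difference A i x p ⟩
    coord i p + (x − p) · normal A i   ≡⟨ cong (coord i p +_) (·-lin (x − p) (L i) (λ m → ι (a m))) ⟩
    coord i p + Σℚ (λ m → L i m * ((x − p) · ι (a m)))
      ≡⟨ cong (coord i p +_) (Σ-const (L i) at-vertex) ⟩
    coord i p + Σℚ (L i) * ((x − p) · p)
      ≡⟨ cong (λ s → coord i p + s * ((x − p) · p)) (L-rowsum i) ⟩
    coord i p + 0ℚ * ((x − p) · p)     ≡⟨ lemma (coord i p) ((x − p) · p) ⟩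
    coord i p                          ∎
    where
    open ≡-Reasoning
    lemma : ∀ s t → s + 0ℚ * t ≡ s
    lemma = solve-∀ ℚ-ring
    vertex-AffineHull : ∀ m → ι (a m) ∈ AffineHull (points S)
    vertex-AffineHull m =
      suc j , (λ i → ι (a i)) , (λ i → coord i (ι (a m))) , vertex-point , coord-sum A (ι (a m)) , λ t → sym (foot-vertex A m t)
    split : ∀ s t → s ≡ s - t + t
    split = solve-∀ ℚ-ring
    at-vertex : ∀ m → (x − p) · ι (a m) ≡ (x − p) · p
    at-vertex m = begin
      (x − p) · ι (a m)                                 ≡⟨ split ((x − p) · ι (a m)) ((x − p) · p) ⟩
      (x − p) · ι (a m) - (x − p) · p + (x − p) · p     ≡⟨ cong (_+ (x − p) · p) (·-−ʳ (x − p) (ι (a m)) p) ⟨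
      (x − p) · (ι (a m) − p) + (x − p) · p             ≡⟨ cong (_+ (x − p) · p) (orthogonal (ι (a m)) (vertex-AffineHull m)) ⟩
      0ℚ + (x − p) · p                                  ≡⟨ +-identityˡ ((x − p) · p) ⟩
      (x − p) · p                                       ∎

  -- Moving from p a little away from the i-th vertex stays in the hull, where coord i is nonnegative.
  interior-coord : ∀ i {p} → p ∈ RelativeInterior Hull → 0ℚ < coord i p
  interior-coord i {p} (p∈ , ε , 0<ε , ball) =
    *-cancel-pos (0<1+ (<⇒≤ 0<t)) (subst (0ℚ <_) positive-product (+-mono-<-≤ 0<t (coord-Hull i y∈)))
    where
    open ≡-Reasoning
    d : ℚ^ N
    d = p − ι (a i)
    R : ℚ
    R = d · d
    0<1+R : 0ℚ < 1ℚ + R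
    0<1+R = 0<1+ (·-nonneg d)
    -- `t` is ε / (1 + R). The displacement t d has squared length t² R, which is below ε² = t² (1 +
    -- R)² without any root of R, and 1 + R is positive even if d vanishes.
    s t : ℚ
    s = proj₁ (inverse 0<1+R)
    t = ε * s
    0<t : 0ℚ < t
    0<t = *-pos 0<ε (proj₁ (proj₂ (inverse 0<1+R)))
    t[1+R]≡ε : t * (1ℚ + R) ≡ ε
    t[1+R]≡ε = cancel-inverse ε (proj₂ (proj₂ (inverse 0<1+R)))
    c : Fin 2 → ℚ
    c = pair (1ℚ + t) (- t)
    y : ℚ^ N
    y = lin c (pair p (ι (a i)))
    Σc≡1 : Σℚ c ≡ 1ℚ
    Σc≡1 = lemma t
      where
      lemma : ∀ t → 1ℚ + t + (- t + 0ℚ) ≡ 1ℚ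
      lemma = solve-∀ ℚ-ring
    ends : ∀ l → pair p (ι (a i)) l ∈ Hull
    ends zero = p∈
    ends (suc _) = coord-nonneg⇒Hull (foot-vertex A i) (λ m → subst (0ℚ ≤ℚ_) (sym (dual m i)) (𝟙-nonneg m i))
    displacement : ∀ u → (y − p) u ≡ t * d u
    displacement u = lemma t (p u) (ι (a i) u)
      where
      lemma : ∀ t x z → (1ℚ + t) * x + ((- t) * z + 0ℚ) - x ≡ t * (x - z)
      lemma = solve-∀ ℚ-ring
    distance : (y − p) · (y − p) ≡ t * t * R
    distance = begin
      (y − p) · (y − p)                 ≡⟨ ·-cong displacement displacement ⟩
      Σℚ (λ u → (t * d u) * (t * d u))  ≡⟨ Σ-cong (λ u → lemma t (d u)) ⟩
      Σℚ (λ u → t * t * (d u * d u))    ≡⟨ Σ-*ˡ (t * t) (λ u → d u * d u) ⟨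
      t * t * R                         ∎
      where
      lemma : ∀ t x → (t * x) * (t * x) ≡ t * t * (x * x)
      lemma = solve-∀ ℚ-ring
    near : (y − p) · (y − p) < ε * ε
    near = 0<-⇒< (subst (0ℚ <_) gap (*-pos (*-pos 0<t 0<t) (+-mono-<-≤ 0<1+R (square-nonneg R))))
      where
      lemma : ∀ t R → t * t * (1ℚ + R + R * R) ≡ t * (1ℚ + R) * (t * (1ℚ + R)) - t * t * R
      lemma = solve-∀ ℚ-ring
      gap : t * t * (1ℚ + R + R * R) ≡ ε * ε - (y − p) · (y − p)
      gap = trans (lemma t R) (cong₂ _-_ (cong₂ _*_ t[1+R]≡ε t[1+R]≡ε) (sym distance))
    y∈ : y ∈ Hull
    y∈ = ball y (2 , pair p (ι (a i)) , c , ends , Σc≡1 , λ _ → refl) near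
    positive-product : t + coord i y ≡ coord i p * (1ℚ + t)
    positive-product = begin
      t + coord i y
        ≡⟨ cong (t +_) (coord-lin i c (pair p (ι (a i))) Σc≡1) ⟩
      t + ((1ℚ + t) * coord i p + ((- t) * coord i (ι (a i)) + 0ℚ))
        ≡⟨ cong (λ z → t + ((1ℚ + t) * coord i p + ((- t) * z + 0ℚ))) (trans (dual i i) (𝟙-diag i)) ⟩
      t + ((1ℚ + t) * coord i p + ((- t) * 1ℚ + 0ℚ))
        ≡⟨ lemma t (coord i p) ⟩
      coord i p * (1ℚ + t) ∎
      where
      lemma : ∀ t z → t + ((1ℚ + t) * z + ((- t) * 1ℚ + 0ℚ)) ≡ z * (1ℚ + t)
      lemma = solve-∀ ℚ-ring

  𝒞⇒coord-positive : ∀ v → v ∈ 𝒞 S → ∀ i → 0ℚ < coord i (ι v)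
  𝒞⇒coord-positive v (p , projection , interior) i =
    subst (0ℚ <_) (sym (coord-projection projection i)) (interior-coord i interior)

  coord-positive⇒𝒞 : ∀ v → (∀ i → 0ℚ < coord i (ι v)) → v ∈ 𝒞 S
  coord-positive⇒𝒞 v 0<coord =
    p , (p∈AffineHull , orthogonal) , (p∈Hull , ε , 0<ε , ball)
    where
    open ≡-Reasoning
    x p : ℚ^ N
    x = ι v
    p = foot x
    p∈AffineHull : p ∈ AffineHull (points S)
    p∈AffineHull = suc j , (λ i → ι (a i)) , (λ i → coord i x) , vertex-point , coord-sum A x , λ _ → refl
    p∈Hull : p ∈ Hull
    p∈Hull = suc j , (λ i → ι (a i)) , (λ i → coord i x) , vertex-point , (λ i → <⇒≤ (0<coord i)) , coord-sum A x , λ _ → refl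
    orthogonal : ∀ q → q ∈ AffineHull (points S) → (x − p) · (q − p) ≡ 0ℚ
    orthogonal q q∈ = begin
      height x · (q − p)             ≡⟨ ·-−ʳ (height x) q p ⟩
      height x · q - height x · p    ≡⟨ cong₂ _-_ (height-AffineHull x q∈) (height-foot A x) ⟩
      γ A x - γ A x                  ≡⟨ +-inverseʳ (γ A x) ⟩
      0ℚ                             ∎
    norm² : Fin (suc j) → ℚ
    norm² i = normal A i · normal A i
    scale : ∃ λ ε → 0ℚ < ε × (∀ i → ε * (1ℚ + norm² i) ≤ℚ coord i x)
    scale = common-scale (λ i → 1ℚ + norm² i) (λ i → coord i x) (λ i → 0<1+ (·-nonneg (normal A i))) 0<coord
    ε : ℚ
    ε = proj₁ scale
    0<ε : 0ℚ < ε
    0<ε = proj₁ (proj₂ scale)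
    ball : ∀ y → y ∈ AffineHull Hull → (y − p) · (y − p) < ε * ε → y ∈ Hull
    ball y y∈ near = coord-nonneg⇒Hull (foot-AffineHull A foot-Hull y∈) (λ i → <⇒≤ (positive-coord i))
      where
      -- Cauchy-Schwarz without roots: |ε n + w|² ≥ 0 and |w|² < ε² give 2 ε (n · w) > - ε² (1 +
      -- |n|²), and by the choice of ε the right side is at least - ε (coord i x). Hence 2 ε (coord
      -- i y) exceeds ε (coord i x).
      positive-coord : ∀ i → 0ℚ < coord i y
      positive-coord i = *-cancel-pos (+-mono-< 0<ε 0<ε) (subst (0ℚ <_) total
        (+-mono-≤-< (·-nonneg u) (+-mono-<-≤ (<⇒0<- near) (+-mono-≤ (*-nonneg (<⇒≤ 0<ε) (≤⇒0≤- (proj₂ (proj₂ scale) i)))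
          (*-nonneg (<⇒≤ 0<ε) (<⇒≤ (0<coord i)))))))
        where
        n w u : ℚ^ N
        n = normal A i
        w = y − p
        u z = ε * n z + w z
        identity : ∀ ε β nn nw ww →
          ε * ε * nn + (ε + ε) * nw + ww + (ε * ε - ww + (ε * (β - ε * (1ℚ + nn)) + ε * β)) ≡ (β + nw) * (ε + ε)
        identity = solve-∀ ℚ-ring
        total : u · u + (ε * ε - w · w + (ε * (coord i x - ε * (1ℚ + norm² i)) + ε * coord i x)) ≡ coord i y * (ε + ε)
        total = begin
          u · u + (ε * ε - w · w + (ε * (coord i x - ε * (1ℚ + norm² i)) + ε * coord i x))
            ≡⟨ cong (_+ (ε * ε - w · w + (ε * (coord i x - ε * (1ℚ + norm² i)) + ε * coord i x))) (·-expand ε n w) ⟩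
          ε * ε * norm² i + (ε + ε) * (n · w) + w · w + (ε * ε - w · w + (ε * (coord i x - ε * (1ℚ + norm² i)) + ε * coord i x))
            ≡⟨ identity ε (coord i x) (norm² i) (n · w) (w · w) ⟩
          (coord i x + n · w) * (ε + ε)
            ≡⟨ cong (_* (ε + ε)) (cong₂ _+_ (sym (coord-foot A i x)) (·-comm n w)) ⟩
          (coord i p + w · n) * (ε + ε)
            ≡⟨ cong (_* (ε + ε)) (coord-difference A i y p) ⟨
          coord i y * (ε + ε) ∎

-- Adding a vertex: the extension criterion.

-- The criterion is detached from geometry, since a larger cube changes only η: monotonicity and
-- decidability then concern numbers alone. Clearing the denominator η keeps `gap` free of division.
record Extends {k} (L : Matrix k k) (β : Fin k → ℚ) (η : ℚ) : Set where
  field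
    β-pos : ∀ i → 0ℚ < β i
    η-pos : 0ℚ < η
    gap   : ∀ i m → i ≢ m → L i m * η + β i * β m < 0ℚ

module _ {N j} {b : Fin (suc (suc j)) → ℚ^ N} (A : Acute (λ i → b (suc i))) where
  open Acute A
  private
    x : ℚ^ N
    x = b zero
    β : Fin (suc j) → ℚ
    β i = coord i x

  -- The dual basis of the larger simplex: h / η for the new vertex, where h is
  -- the height, and the old dual vectors corrected by multiples of it.
  extend : Extends L β (η x) → Acute b
  extend extends = record { L = L′ ; κ = κ′ ; L-rowsum = rowsum ; dual = dual′ ; L-neg = neg }
    where
    open ≡-Reasoning
    open Extends extends
    r g : ℚ
    r = proj₁ (inverse η-pos)
    g = γ A x
    0<r : 0ℚ < r
    0<r = proj₁ (proj₂ (inverse η-pos))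
    rη≡1 : r * η x ≡ 1ℚ
    rη≡1 = proj₂ (proj₂ (inverse η-pos))
    L′ : Matrix (suc (suc j)) (suc (suc j))
    L′ zero zero = r
    L′ zero (suc m) = β m * - r
    L′ (suc i) zero = β i * - r
    L′ (suc i) (suc m) = L i m + β m * (β i * r)
    -- These constants make the new coordinate (height x · y - γ) / η, which vanishes on the old
    -- vertices, and turn each old coordinate into itself minus β i times the new one.
    κ′ : Fin (suc (suc j)) → ℚ
    κ′ zero = - (g * r)
    κ′ (suc i) = κ i + β i * (g * r)
    rowsum : ∀ i → Σℚ (L′ i) ≡ 0ℚ
    rowsum zero = begin
      r + Σℚ (λ m → β m * - r)   ≡⟨ cong (r +_) (Σ-*ʳ β (- r)) ⟨
      r + Σℚ β * - r             ≡⟨ cong (λ s → r + s * - r) (coord-sum A x) ⟩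
      r + 1ℚ * - r               ≡⟨ lemma r ⟩
      0ℚ                         ∎
      where
      lemma : ∀ r → r + 1ℚ * - r ≡ 0ℚ
      lemma = solve-∀ ℚ-ring
    rowsum (suc i) = begin
      β i * - r + Σℚ (λ m → L i m + β m * (β i * r))
        ≡⟨ cong (β i * - r +_) (Σ-+ (L i) (λ m → β m * (β i * r))) ⟩
      β i * - r + (Σℚ (L i) + Σℚ (λ m → β m * (β i * r)))
        ≡⟨ cong (β i * - r +_) (cong₂ _+_ (L-rowsum i) (sym (Σ-*ʳ β (β i * r)))) ⟩
      β i * - r + (0ℚ + Σℚ β * (β i * r))
        ≡⟨ cong (λ s → β i * - r + (0ℚ + s * (β i * r))) (coord-sum A x) ⟩
      β i * - r + (0ℚ + 1ℚ * (β i * r))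
        ≡⟨ lemma (β i) r ⟩
      0ℚ ∎
      where
      lemma : ∀ b r → b * - r + (0ℚ + 1ℚ * (b * r)) ≡ 0ℚ
      lemma = solve-∀ ℚ-ring
    coord′ : Fin (suc (suc j)) → ℚ^ N → ℚ
    coord′ i y = Σℚ (λ m → L′ i m * (b m · y)) + κ′ i
    Σ-foot : ∀ y s → Σℚ (λ m → β m * s * (b (suc m) · y)) ≡ (foot x · y) * s
    Σ-foot y s = begin
      Σℚ (λ m → β m * s * (b (suc m) · y))
        ≡⟨ Σ-cong (λ m → trans (exchange (β m) s (b (suc m) · y)) (cong (λ z → β m * z * s) (·-comm (b (suc m)) y))) ⟩
      Σℚ (λ m → β m * (y · b (suc m)) * s)     ≡⟨ Σ-*ʳ (λ m → β m * (y · b (suc m))) s ⟨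
      Σℚ (λ m → β m * (y · b (suc m))) * s     ≡⟨ cong (_* s) (·-lin y β (λ m → b (suc m))) ⟨
      (y · foot x) * s                         ≡⟨ cong (_* s) (·-comm y (foot x)) ⟩
      (foot x · y) * s                         ∎
      where
      exchange : ∀ u v w → u * v * w ≡ u * w * v
      exchange = solve-∀ ℚ-ring
    coord′-zero : ∀ y → coord′ zero y ≡ (height x · y - g) * r
    coord′-zero y = begin
      r * (x · y) + Σℚ (λ m → β m * - r * (b (suc m) · y)) + - (g * r)
        ≡⟨ cong (λ z → r * (x · y) + z + - (g * r)) (Σ-foot y (- r)) ⟩
      r * (x · y) + (foot x · y) * - r + - (g * r)
        ≡⟨ lemma r (x · y) (foot x · y) g ⟩
      (x · y - foot x · y - g) * r
        ≡⟨ cong (λ z → (z - g) * r) (·-−ˡ x (foot x) y) ⟨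
      (height x · y - g) * r ∎
      where
      lemma : ∀ r s t g → r * s + t * - r + - (g * r) ≡ (s - t - g) * r
      lemma = solve-∀ ℚ-ring
    coord′-suc : ∀ i y → coord′ (suc i) y ≡ coord i y - β i * coord′ zero y
    coord′-suc i y = begin
      β i * - r * (x · y) + Σℚ (λ m → (L i m + β m * (β i * r)) * (b (suc m) · y)) + (κ i + β i * (g * r))
        ≡⟨ cong (λ z → β i * - r * (x · y) + z + (κ i + β i * (g * r)))
             (trans (Σ-cong (λ m → *-distribʳ-+ (b (suc m) · y) (L i m) (β m * (β i * r))))
               (trans (Σ-+ (λ m → L i m * (b (suc m) · y)) (λ m → β m * (β i * r) * (b (suc m) · y)))
                 (cong (Σℚ (λ m → L i m * (b (suc m) · y)) +_) (Σ-foot y (β i * r))))) ⟩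
      β i * - r * (x · y) + (Σℚ (λ m → L i m * (b (suc m) · y)) + (foot x · y) * (β i * r)) + (κ i + β i * (g * r))
        ≡⟨ lemma (β i) r (x · y) (Σℚ (λ m → L i m * (b (suc m) · y))) (foot x · y) (κ i) g ⟩
      coord i y - β i * ((x · y - foot x · y - g) * r)
        ≡⟨ cong (λ z → coord i y - β i * ((z - g) * r)) (·-−ˡ x (foot x) y) ⟨
      coord i y - β i * ((height x · y - g) * r)
        ≡⟨ cong (λ z → coord i y - β i * z) (coord′-zero y) ⟨
      coord i y - β i * coord′ zero y ∎
      where
      lemma : ∀ b r s t f k g → b * - r * s + (t + f * (b * r)) + (k + b * (g * r)) ≡ t + k - b * ((s - f - g) * r)
      lemma = solve-∀ ℚ-ring
    zero-zero : coord′ zero x ≡ 1ℚ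
    zero-zero = begin
      coord′ zero x            ≡⟨ coord′-zero x ⟩
      (height x · x - g) * r   ≡⟨ cong (λ z → (z - g) * r) (height-self A x) ⟩
      (η x + g - g) * r        ≡⟨ lemma (η x) g r ⟩
      r * η x                  ≡⟨ rη≡1 ⟩
      1ℚ                       ∎
      where
      lemma : ∀ e g r → (e + g - g) * r ≡ r * e
      lemma = solve-∀ ℚ-ring
    zero-suc : ∀ l → coord′ zero (b (suc l)) ≡ 0ℚ
    zero-suc l = begin
      coord′ zero (b (suc l))            ≡⟨ coord′-zero (b (suc l)) ⟩
      (height x · b (suc l) - g) * r     ≡⟨ cong (λ z → (z - g) * r) (height-vertex A x l) ⟩
      (g - g) * r                        ≡⟨ lemma g r ⟩
      0ℚ                                 ∎
      where
      lemma : ∀ g r → (g - g) * r ≡ 0ℚ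
      lemma = solve-∀ ℚ-ring
    dual′ : ∀ i l → coord′ i (b l) ≡ 𝟙 i l
    dual′ zero zero = zero-zero
    dual′ zero (suc l) = zero-suc l
    dual′ (suc i) zero = trans (coord′-suc i x) (trans (cong (λ z → β i - β i * z) zero-zero) (lemma (β i)))
      where
      lemma : ∀ b → b - b * 1ℚ ≡ 0ℚ
      lemma = solve-∀ ℚ-ring
    dual′ (suc i) (suc l) = begin
      coord′ (suc i) (b (suc l))                          ≡⟨ coord′-suc i (b (suc l)) ⟩
      coord i (b (suc l)) - β i * coord′ zero (b (suc l)) ≡⟨ cong₂ (λ y z → y - β i * z) (dual i l) (zero-suc l) ⟩
      𝟙 i l - β i * 0ℚ                                    ≡⟨ lemma (𝟙 i l) (β i) ⟩
      𝟙 i l                                               ≡⟨ 𝟙-suc i l ⟨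
      𝟙 (suc i) (suc l)                                   ∎
      where
      lemma : ∀ s b → s - b * 0ℚ ≡ s
      lemma = solve-∀ ℚ-ring
    neg₀ : ∀ i → β i * - r < 0ℚ
    neg₀ i = subst (_< 0ℚ) (neg-distribʳ-* (β i) r) (neg-antimono-< (*-pos (β-pos i) 0<r))
    neg : ∀ i m → i ≢ m → L′ i m < 0ℚ
    neg zero zero 0≢0 = contradiction refl 0≢0
    neg zero (suc m) _ = neg₀ m
    neg (suc i) zero _ = neg₀ i
    neg (suc i) (suc m) i≢m = *-cancel-neg η-pos (subst (_< 0ℚ) (sym scaled) (gap i m (i≢m ∘ cong suc)))
      where
      lemma : ∀ l b c r e → (l + c * (b * r)) * e ≡ l * e + b * c * (r * e)
      lemma = solve-∀ ℚ-ring
      scaled : L′ (suc i) (suc m) * η x ≡ L i m * η x + β i * β m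
      scaled = trans (lemma (L i m) (β i) (β m) r (η x))
        (cong (L i m * η x +_) (trans (cong (β i * β m *_) rη≡1) (*-identityʳ (β i * β m))))

  -- Going from foot x, an affine combination of old vertices with weights β, to x changes
  -- `B.coord i` by B.L i zero · η. With `B.dual` this fixes column zero of B.L: its top entry times
  -- η is 1, so η cannot vanish, and the other entries times η are - β i. `coord-exchange` between
  -- the two simplices then recovers L from B.L.
  restrict : Acute b → Extends L β (η x)
  restrict B = record { β-pos = positive-β ; η-pos = positive-η ; gap = gap′ }
    where
    open ≡-Reasoning
    module B = Acute B
    height-normal : ∀ i → height x · normal B i ≡ B.L i zero * η x
    height-normal i = begin
      height x · normal B i
        ≡⟨ ·-lin (height x) (B.L i) b ⟩
      B.L i zero * (height x · x) + Σℚ (λ m → B.L i (suc m) * (height x · b (suc m)))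
        ≡⟨ cong₂ (λ y z → B.L i zero * y + z) (height-self A x) (Σ-const (λ m → B.L i (suc m)) (height-vertex A x)) ⟩
      B.L i zero * (η x + γ A x) + Σℚ (λ m → B.L i (suc m)) * γ A x
        ≡⟨ lemma (B.L i zero) (η x) (γ A x) (Σℚ (λ m → B.L i (suc m))) ⟩
      B.L i zero * η x + Σℚ (B.L i) * γ A x
        ≡⟨ cong (λ s → B.L i zero * η x + s * γ A x) (B.L-rowsum i) ⟩
      B.L i zero * η x + 0ℚ * γ A x
        ≡⟨ lemma′ (B.L i zero * η x) (γ A x) ⟩
      B.L i zero * η x ∎
      where
      lemma : ∀ l e g s → l * (e + g) + s * g ≡ l * e + (l + s) * g
      lemma = solve-∀ ℚ-ring
      lemma′ : ∀ s g → s + 0ℚ * g ≡ s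
      lemma′ = solve-∀ ℚ-ring
    column : ∀ i → 𝟙 i zero ≡ Σℚ (λ l → β l * 𝟙 i (suc l)) + B.L i zero * η x
    column i = begin
      𝟙 i zero                                       ≡⟨ B.dual i zero ⟨
      B.coord i x                                    ≡⟨ coord-difference B i x (foot x) ⟩
      B.coord i (foot x) + height x · normal B i
        ≡⟨ cong₂ _+_
             (trans (B.coord-lin i β (λ l → b (suc l)) (coord-sum A x)) (Σ-cong (λ l → cong (β l *_) (B.dual i (suc l)))))
             (height-normal i) ⟩
      Σℚ (λ l → β l * 𝟙 i (suc l)) + B.L i zero * η x ∎
    column-zero : B.L zero zero * η x ≡ 1ℚ
    column-zero = sym (trans (column zero) (trans
       (cong (_+ B.L zero zero * η x) (Σ-zero (λ l → *-zeroʳ (β l)))) (+-identityˡ (B.L zero zero * η x))))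
    column-suc : ∀ i → β i + B.L (suc i) zero * η x ≡ 0ℚ
    column-suc i = sym (trans (column (suc i)) (cong (_+ B.L (suc i) zero * η x)
      (trans (Σ-cong (λ l → cong (β l *_) (𝟙-suc i l))) (Σ-𝟙ˡ β i))))
    positive-η : 0ℚ < η x
    positive-η with <-cmp 0ℚ (η x)
    ... | tri< 0<η _ _ = 0<η
    ... | tri≈ _ 0≡η _ = contradiction
      (trans (sym column-zero) (trans (cong (B.L zero zero *_) (sym 0≡η)) (*-zeroʳ (B.L zero zero)))) 1≢0
    ... | tri> _ _ η<0 = contradiction (<-≤-trans η<0 (·-nonneg (height x))) (<-irrefl refl)
    positive-β : ∀ i → 0ℚ < β i
    positive-β i = 0<-⇒< (subst (0ℚ <_) opposite (neg-antimono-< (*-neg-pos (B.L-neg (suc i) zero λ ()) positive-η)))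
      where
      lemma : ∀ s t → - t ≡ s - 0ℚ - (s + t)
      lemma = solve-∀ ℚ-ring
      lemma′ : ∀ s → s - 0ℚ - 0ℚ ≡ s - 0ℚ
      lemma′ = solve-∀ ℚ-ring
      opposite : - (B.L (suc i) zero * η x) ≡ β i - 0ℚ
      opposite = trans (lemma (β i) (B.L (suc i) zero * η x)) (trans (cong (λ z → β i - 0ℚ - z) (column-suc i)) (lemma′ (β i)))
    exchange : ∀ i m → L m i ≡ B.L (suc i) zero * β m + B.L (suc i) (suc m)
    exchange i m = begin
      L m i
        ≡⟨ Σ-𝟙ˡ (L m) i ⟨
      Σℚ (λ t → L m t * 𝟙 i t)
        ≡⟨ Σ-cong (λ t → cong (L m t *_) (trans (B.dual (suc i) (suc t)) (𝟙-suc i t))) ⟨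
      Σℚ (λ t → L m t * B.coord (suc i) (b (suc t)))
        ≡⟨ coord-exchange A B m (suc i) ⟩
      B.L (suc i) zero * β m + Σℚ (λ t → B.L (suc i) (suc t) * coord m (b (suc t)))
        ≡⟨ cong (B.L (suc i) zero * β m +_) (trans
             (Σ-cong (λ t → cong (B.L (suc i) (suc t) *_) (dual m t)))
             (Σ-𝟙ˡ (λ t → B.L (suc i) (suc t)) m)) ⟩
      B.L (suc i) zero * β m + B.L (suc i) (suc m) ∎
    gap′ : ∀ i m → i ≢ m → L i m * η x + β i * β m < 0ℚ
    gap′ i m i≢m = subst (_< 0ℚ) scaled (*-neg-pos (B.L-neg (suc m) (suc i) (λ { refl → i≢m refl })) positive-η)
      where
      lemma : ∀ l e b c s → l * e + b * (c + s * e) ≡ (s * b + l) * e + b * c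
      lemma = solve-∀ ℚ-ring
      scaled : B.L (suc m) (suc i) * η x ≡ L i m * η x + β i * β m
      scaled = begin
        B.L (suc m) (suc i) * η x
          ≡⟨ trans (cong (B.L (suc m) (suc i) * η x +_) (*-zeroʳ (β i))) (+-identityʳ (B.L (suc m) (suc i) * η x)) ⟨
        B.L (suc m) (suc i) * η x + β i * 0ℚ
          ≡⟨ cong (λ z → B.L (suc m) (suc i) * η x + β i * z) (column-suc m) ⟨
        B.L (suc m) (suc i) * η x + β i * (β m + B.L (suc m) zero * η x)
          ≡⟨ lemma (B.L (suc m) (suc i)) (η x) (β i) (β m) (B.L (suc m) zero) ⟩
        (B.L (suc m) zero * β i + B.L (suc m) (suc i)) * η x + β i * β m
          ≡⟨ cong (λ z → z * η x + β i * β m) (exchange m i) ⟨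
        L i m * η x + β i * β m ∎

-- Change of enumeration, and the comparison with inverse Gram matrices.

module _ {M N k l} {a : Fin k → ℚ^ M} {b : Fin l → ℚ^ N} (π : Permutation k l)
         (a·a≡b·b : ∀ i m → a i · a m ≡ b (π ⟨$⟩ʳ i) · b (π ⟨$⟩ʳ m)) where

  -- The fields of `Acute` see the vertices only through inner products, so the two families may
  -- even lie in spaces of different dimension.
  Acute-reindex : Acute b → Acute a
  Acute-reindex B = record
    { L        = λ i m → L (π ⟨$⟩ʳ i) (π ⟨$⟩ʳ m)
    ; κ        = λ i → κ (π ⟨$⟩ʳ i)
    ; L-rowsum = λ i → trans (sym (Sum.sum-permute (L (π ⟨$⟩ʳ i)) π)) (L-rowsum (π ⟨$⟩ʳ i))
    ; dual     = dual′
    ; L-neg    = λ i m i≢m → L-neg (π ⟨$⟩ʳ i) (π ⟨$⟩ʳ m) (i≢m ∘ injective)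
    }
    where
    open Acute B
    open ≡-Reasoning
    injective : ∀ {i m} → π ⟨$⟩ʳ i ≡ π ⟨$⟩ʳ m → i ≡ m
    injective eq = trans (sym (inverseˡ π)) (trans (cong (π ⟨$⟩ˡ_) eq) (inverseˡ π))
    𝟙-permute : ∀ i m → 𝟙 (π ⟨$⟩ʳ i) (π ⟨$⟩ʳ m) ≡ 𝟙 i m
    𝟙-permute i m with i ≟ m
    ... | yes refl = 𝟙-diag (π ⟨$⟩ʳ i)
    ... | no i≢m = 𝟙-off (i≢m ∘ injective)
    dual′ : ∀ i m → Σℚ (λ t → L (π ⟨$⟩ʳ i) (π ⟨$⟩ʳ t) * (a t · a m)) + κ (π ⟨$⟩ʳ i) ≡ 𝟙 i m
    dual′ i m = begin
      Σℚ (λ t → L (π ⟨$⟩ʳ i) (π ⟨$⟩ʳ t) * (a t · a m)) + κ (π ⟨$⟩ʳ i)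
        ≡⟨ cong (_+ κ (π ⟨$⟩ʳ i)) (Σ-cong (λ t → cong (L (π ⟨$⟩ʳ i) (π ⟨$⟩ʳ t) *_) (a·a≡b·b t m))) ⟩
      Σℚ (λ t → L (π ⟨$⟩ʳ i) (π ⟨$⟩ʳ t) * (b (π ⟨$⟩ʳ t) · b (π ⟨$⟩ʳ m))) + κ (π ⟨$⟩ʳ i)
        ≡⟨ cong (_+ κ (π ⟨$⟩ʳ i)) (Sum.sum-permute (λ s → L (π ⟨$⟩ʳ i) s * (b s · b (π ⟨$⟩ʳ m))) π) ⟨
      Σℚ (λ s → L (π ⟨$⟩ʳ i) s * (b s · b (π ⟨$⟩ʳ m))) + κ (π ⟨$⟩ʳ i)
        ≡⟨ dual (π ⟨$⟩ʳ i) (π ⟨$⟩ʳ m) ⟩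
      𝟙 (π ⟨$⟩ʳ i) (π ⟨$⟩ʳ m)
        ≡⟨ 𝟙-permute i m ⟩
      𝟙 i m ∎

module _ {N j} (a : Fin (suc j) → ℚ^ N) where
  private
    p : Fin j → ℚ^ N
    p i = a (suc i) − a zero

  -- A combination of edges is a combination of vertices with weights summing to zero; the weight of
  -- `a zero` is the border entry of L.
  Σ-edges : ∀ c y → - Σℚ c * (a zero · y) + Σℚ (λ i → c i * (a (suc i) · y)) ≡ Σℚ (λ i → c i * (p i · y))
  Σ-edges c y = begin
    - Σℚ c * (a zero · y) + Σℚ (λ i → c i * (a (suc i) · y))
      ≡⟨ lemma (Σℚ c) (a zero · y) (Σℚ (λ i → c i * (a (suc i) · y))) ⟩
    Σℚ (λ i → c i * (a (suc i) · y)) + Σℚ c * - (a zero · y)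
      ≡⟨ Σ-shift c (λ i → a (suc i) · y) (- (a zero · y)) ⟨
    Σℚ (λ i → c i * (a (suc i) · y - a zero · y))
      ≡⟨ Σ-cong (λ i → cong (c i *_) (·-−ˡ (a (suc i)) (a zero) y)) ⟨
    Σℚ (λ i → c i * (p i · y)) ∎
    where
    open ≡-Reasoning
    lemma : ∀ s t u → - s * t + u ≡ u + s * - t
    lemma = solve-∀ ℚ-ring

  -- Bordering H by its negated row sums turns the two sign conditions, negative off-diagonal
  -- entries and positive row sums, into the single one on L.
  HasAcuteAngles⇒Acute : HasAcuteAngles a → Acute a
  HasAcuteAngles⇒Acute (H , (GH≡1 , HG≡1) , H-neg , R-pos) =
    record { L = L ; κ = κ ; L-rowsum = rowsum ; dual = dual ; L-neg = neg }
    where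
    open ≡-Reasoning
    R : Fin j → ℚ
    R i = Σℚ (H i)
    L : Matrix (suc j) (suc j)
    -- The double negation gives row zero the same shape as the others, minus a sum followed by its
    -- terms, so `Σ-edges` applies to it as it stands.
    L zero zero = - Σℚ (λ i → - R i)
    L zero (suc m) = - R m
    L (suc i) zero = - R i
    L (suc i) (suc m) = H i m
    -- Normalised at `a zero`, where the coordinate of index zero must be 1 and the others 0.
    κ : Fin (suc j) → ℚ
    κ zero = 1ℚ - Σℚ (λ m → - R m * (p m · a zero))
    κ (suc i) = - Σℚ (λ m → H i m * (p m · a zero))
    rowsum : ∀ i → Σℚ (L i) ≡ 0ℚ
    rowsum zero = +-inverseˡ (Σℚ (λ i → - R i))
    rowsum (suc i) = +-inverseˡ (R i)
    Σ-difference : ∀ c y → Σℚ (λ m → c m * (p m · y)) - Σℚ (λ m → c m * (p m · a zero)) ≡ Σℚ (λ m → c m * (p m · (y − a zero)))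
    Σ-difference c y = trans (sym (Σ-- (λ m → c m * (p m · y)) (λ m → c m * (p m · a zero))))
      (Σ-cong (λ m → trans (lemma (c m) (p m · y) (p m · a zero)) (cong (c m *_) (sym (·-−ʳ (p m) y (a zero))))))
      where
      lemma : ∀ c s t → c * s - c * t ≡ c * (s - t)
      lemma = solve-∀ ℚ-ring
    Σ-at-zero : ∀ c → Σℚ (λ m → c m * (p m · (a zero − a zero))) ≡ 0ℚ
    Σ-at-zero c = trans (sym (Σ-difference c (a zero))) (+-inverseʳ (Σℚ (λ m → c m * (p m · a zero))))
    coord : Fin (suc j) → ℚ^ N → ℚ
    coord i y = Σℚ (λ m → L i m * (a m · y)) + κ i
    coord-suc : ∀ i y → coord (suc i) y ≡ Σℚ (λ m → H i m * (p m · (y − a zero)))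
    coord-suc i y = trans (cong (_+ κ (suc i)) (Σ-edges (H i) y)) (Σ-difference (H i) y)
    coord-zero : ∀ y → coord zero y ≡ 1ℚ + Σℚ (λ m → - R m * (p m · (y − a zero)))
    coord-zero y = begin
      coord zero y
        ≡⟨ cong (_+ κ zero) (Σ-edges (λ m → - R m) y) ⟩
      Σℚ (λ m → - R m * (p m · y)) + (1ℚ - Σℚ (λ m → - R m * (p m · a zero)))
        ≡⟨ lemma (Σℚ (λ m → - R m * (p m · y))) (Σℚ (λ m → - R m * (p m · a zero))) ⟩
      1ℚ + (Σℚ (λ m → - R m * (p m · y)) - Σℚ (λ m → - R m * (p m · a zero)))
        ≡⟨ cong (1ℚ +_) (Σ-difference (λ m → - R m) y) ⟩
      1ℚ + Σℚ (λ m → - R m * (p m · (y − a zero))) ∎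
      where
      lemma : ∀ s t → s + (1ℚ - t) ≡ 1ℚ + (s - t)
      lemma = solve-∀ ℚ-ring
    -- R is H applied to the all-ones vector, so the Gram matrix sends R back to that vector.
    Σ-R : ∀ l → Σℚ (λ m → - R m * (p m · p l)) ≡ - 1ℚ
    Σ-R l = begin
      Σℚ (λ m → - R m * (p m · p l))
        ≡⟨ Σ-cong (λ m → lemma (R m) (p m · p l) ) ⟩
      Σℚ (λ m → - ((p m · p l) * R m))
        ≡⟨ Σ-neg (λ m → (p m · p l) * R m) ⟩
      - Σℚ (λ m → (p m · p l) * R m)
        ≡⟨ cong -_ (Σ-cong (λ m → cong₂ _*_ (·-comm (p m) (p l)) (Σ-cong (λ s → sym (*-identityˡ (H m s)))))) ⟩
      - Σℚ (λ m → (p l · p m) * Σℚ (λ s → 1ℚ * H m s))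
        ≡⟨ cong -_ (Σ-swap (λ m → p l · p m) (λ _ → 1ℚ) H) ⟩
      - Σℚ (λ s → 1ℚ * Σℚ (λ m → (p l · p m) * H m s))
        ≡⟨ cong -_ (Σ-cong (λ s → cong (1ℚ *_) (GH≡1 l s))) ⟩
      - Σℚ (λ s → 1ℚ * 𝟙 l s)
        ≡⟨ cong -_ (Σ-𝟙ˡ (λ _ → 1ℚ) l) ⟩
      - 1ℚ ∎
      where
      lemma : ∀ r s → - r * s ≡ - (s * r)
      lemma = solve-∀ ℚ-ring
    dual : ∀ i l → coord i (a l) ≡ 𝟙 i l
    dual zero zero = trans (coord-zero (a zero)) (cong (1ℚ +_) (Σ-at-zero (λ m → - R m)))
    dual zero (suc l) = trans (coord-zero (a (suc l))) (cong (1ℚ +_) (Σ-R l))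
    dual (suc i) zero = trans (coord-suc i (a zero)) (Σ-at-zero (H i))
    dual (suc i) (suc l) = trans (coord-suc i (a (suc l))) (trans (HG≡1 i l) (sym (𝟙-suc i l)))
    neg : ∀ i m → i ≢ m → L i m < 0ℚ
    neg zero zero 0≢0 = contradiction refl 0≢0
    neg zero (suc m) _ = neg-antimono-< (R-pos m)
    neg (suc i) zero _ = neg-antimono-< (R-pos i)
    neg (suc i) (suc m) i≢m = H-neg i m (i≢m ∘ cong suc)

module _ {N j} {a : Fin (suc j) → ℚ^ N} (A : Acute a) where
  open Acute A
  open ≡-Reasoning
  private
    p : Fin j → ℚ^ N
    p i = a (suc i) − a zero

  -- Undoes the bordering. An entry of HG is the difference of `coord (suc i)` between a vertex and
  -- `a zero`; GH follows by transposing, as L is symmetric.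
  Acute⇒HasAcuteAngles : HasAcuteAngles a
  Acute⇒HasAcuteAngles =
    (λ i m → L (suc i) (suc m)) , (GH≡1 , HG≡1) , (λ i m i≢m → L-neg (suc i) (suc m) λ { refl → i≢m refl }) , rows
    where
    opposite : ∀ i → - Σℚ (λ m → L (suc i) (suc m)) ≡ L (suc i) zero
    opposite i = trans (lemma (L (suc i) zero) (Σℚ (λ m → L (suc i) (suc m)))) (trans
       (cong (λ s → L (suc i) zero - s) (L-rowsum (suc i))) (+-identityʳ (L (suc i) zero)))
      where
      lemma : ∀ s t → - t ≡ s - (s + t)
      lemma = solve-∀ ℚ-ring
    HG≡1 : ∀ i l → Σℚ (λ m → L (suc i) (suc m) * (p m · p l)) ≡ 𝟙 i l
    HG≡1 i l = begin
      Σℚ (λ m → L (suc i) (suc m) * (p m · p l))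
        ≡⟨ Σ-edges a (λ m → L (suc i) (suc m)) (p l) ⟨
      - Σℚ (λ m → L (suc i) (suc m)) * (a zero · p l) + Σℚ (λ m → L (suc i) (suc m) * (a (suc m) · p l))
        ≡⟨ cong (λ z → z * (a zero · p l) + Σℚ (λ m → L (suc i) (suc m) * (a (suc m) · p l))) (opposite i) ⟩
      Σℚ (λ m → L (suc i) m * (a m · p l))
        ≡⟨ ·-normal A (p l) (suc i) ⟨
      p l · normal A (suc i)
        ≡⟨ +-identityˡ (p l · normal A (suc i)) ⟨
      0ℚ + p l · normal A (suc i)
        ≡⟨ cong (_+ p l · normal A (suc i)) (dual (suc i) zero) ⟨
      coord (suc i) (a zero) + p l · normal A (suc i)
        ≡⟨ coord-difference A (suc i) (a (suc l)) (a zero) ⟨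
      coord (suc i) (a (suc l))
        ≡⟨ dual (suc i) (suc l) ⟩
      𝟙 (suc i) (suc l)
        ≡⟨ 𝟙-suc i l ⟩
      𝟙 i l ∎
    GH≡1 : ∀ i l → Σℚ (λ m → (p i · p m) * L (suc m) (suc l)) ≡ 𝟙 i l
    GH≡1 i l = trans
      (Σ-cong (λ m → trans (*-comm (p i · p m) (L (suc m) (suc l))) (cong₂ _*_ (L-sym A (suc m) (suc l)) (·-comm (p i) (p m)))))
      (trans (HG≡1 l i) (𝟙-comm l i))
    rows : ∀ i → 0ℚ < Σℚ (λ m → L (suc i) (suc m))
    rows i = subst (0ℚ <_)
      (trans (cong -_ (sym (opposite i))) (lemma (Σℚ (λ m → L (suc i) (suc m)))))
      (neg-antimono-< (L-neg (suc i) zero λ ()))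
      where
      lemma : ∀ s → - - s ≡ s
      lemma = solve-∀ ℚ-ring

  -- The coordinate function of index l, applied along the relation, returns c l on one side and
  -- zero on the other.
  Acute⇒AffinelyIndependent : AffinelyIndependent a
  Acute⇒AffinelyIndependent c Σc≡0 lin≡0 l = begin
    c l
      ≡⟨ Σ-𝟙ˡ c l ⟨
    Σℚ (λ t → c t * 𝟙 l t)
      ≡⟨ Σ-cong (λ t → cong (c t *_) (dual l t)) ⟨
    Σℚ (λ t → c t * coord l (a t))
      ≡⟨ Σ-shift₀ c (λ t → Σℚ (λ m → L l m * (a m · a t))) (κ l) Σc≡0 ⟩
    Σℚ (λ t → c t * Σℚ (λ m → L l m * (a m · a t)))
      ≡⟨ Σ-swap c (L l) (λ t m → a m · a t) ⟩
    Σℚ (λ m → L l m * Σℚ (λ t → c t * (a m · a t)))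
      ≡⟨ Σ-cong (λ m → cong (L l m *_) (·-lin (a m) c a)) ⟨
    Σℚ (λ m → L l m * (a m · lin c a))
      ≡⟨ Σ-const (L l) (λ m → Σ-zero (λ t → trans (cong (a m t *_) (lin≡0 t)) (*-zeroʳ (a m t)))) ⟩
    Σℚ (L l) * 0ℚ
      ≡⟨ *-zeroʳ (Σℚ (L l)) ⟩
    0ℚ ∎

-- From enumerations to sets of cube vertices.

Image : ∀ {N k} → (Fin k → Cube N) → Pred (Cube N) 0ℓ
Image a x = ∃[ i ] a i ≡ x

Acute⇒IsAcuteSimplex : ∀ {N j} {S : Pred (Cube N) 0ℓ} (a : Fin (suc j) → Cube N) →
  S ≐ Image a → Acute (λ i → ι (a i)) → IsAcuteSimplex j S
Acute⇒IsAcuteSimplex a S≐a A = a , S≐a , Acute⇒AffinelyIndependent A , Acute⇒HasAcuteAngles A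

-- The two inclusions send each entry to a position in the other list, and injectivity makes these
-- maps mutually inverse. The permutation also yields k ≡ l, which is how vertices get counted.
enumeration-permutation : ∀ {N k l} {S : Pred (Cube N) 0ℓ} {a : Fin k → Cube N} {b : Fin l → Cube N} →
  S ≐ Image a → S ≐ Image b → (∀ {i m} → a i ≡ a m → i ≡ m) → (∀ {i m} → b i ≡ b m → i ≡ m) →
  ∃ λ (π : Permutation k l) → ∀ i → a i ≡ b (π ⟨$⟩ʳ i)
enumeration-permutation {k = k} {l} {a = a} {b} (S⊆a , a⊆S) (S⊆b , b⊆S) a-injective b-injective =
  permutation to from
    (λ m → b-injective (trans (b-to (from m)) (a-from m)))
    (λ i → a-injective (trans (a-from (to i)) (b-to i))) ,
  λ i → sym (b-to i)
  where
  to : Fin k → Fin l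
  to i = proj₁ (S⊆b (a⊆S (i , refl)))
  b-to : ∀ i → b (to i) ≡ a i
  b-to i = proj₂ (S⊆b (a⊆S (i , refl)))
  from : Fin l → Fin k
  from m = proj₁ (S⊆a (b⊆S (m , refl)))
  a-from : ∀ m → a (from m) ≡ b m
  a-from m = proj₂ (S⊆a (b⊆S (m , refl)))

Acute-injective : ∀ {N k} {a : Fin k → Cube N} → Acute (λ i → ι (a i)) → ∀ {i m} → a i ≡ a m → i ≡ m
Acute-injective A ai≡am = Acute.vertex-injective A (cong-app (cong ι ai≡am))

-- The new vertex goes in front, so that dropping index zero gives back `a` by computation, the form
-- that `extend` and `restrict` expect.
cons : ∀ {N k} → Cube N → (Fin k → Cube N) → Fin (suc k) → Cube N
cons v a zero = v
cons v a (suc i) = a i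

Image-cons : ∀ {N k} {S : Pred (Cube N) 0ℓ} {a : Fin k → Cube N} v → S ≐ Image a → S ∪ ｛ v ｝ ≐ Image (cons v a)
Image-cons {S = S} {a} v (S⊆a , a⊆S) = forth , back
  where
  forth : S ∪ ｛ v ｝ ⊆ Image (cons v a)
  forth (inj₁ x∈S) with S⊆a x∈S
  ... | i , ai≡x = suc i , ai≡x
  forth (inj₂ v≡x) = zero , v≡x
  back : Image (cons v a) ⊆ S ∪ ｛ v ｝
  back (zero , v≡x) = inj₂ v≡x
  back (suc i , ai≡x) = inj₁ (a⊆S (i , ai≡x))

module _ {N j} {S : Pred (Cube N) 0ℓ} {a : Fin (suc j) → Cube N} (S≐a : S ≐ Image a) (A : Acute (λ i → ι (a i))) where
  open Acute A

  Extends⇒𝒜 : ∀ {v} → Extends L (λ i → coord i (ι v)) (η (ι v)) → v ∈ 𝒜 S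
  Extends⇒𝒜 {v} extends =
    j , Acute⇒IsAcuteSimplex a S≐a A ,
    Acute⇒IsAcuteSimplex (cons v a) (Image-cons v S≐a) (extend {b = λ i → ι (cons v a i)} A extends)

  𝒜⇒Extends : ∀ {v} → v ∈ 𝒜 S → Extends L (λ i → coord i (ι v)) (η (ι v))
  𝒜⇒Extends {v} (j′ , (a′ , S≐a′ , _ , angles′) , (b , Sv≐b , _ , angles)) =
    restrict {b = λ i → ι (cons v a i)} A (Acute-reindex (proj₁ matching)
      (λ i m → cong₂ (λ y z → ι y · ι z) (proj₂ matching i) (proj₂ matching m)) B)
    where
    B : Acute (λ i → ι (b i))
    B = HasAcuteAngles⇒Acute (λ i → ι (b i)) angles
    j≡j′ : suc j ≡ suc j′
    j≡j′ = ↔⇒≡ (proj₁ (enumeration-permutation S≐a S≐a′ (Acute-injective A)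
      (Acute-injective (HasAcuteAngles⇒Acute (λ i → ι (a′ i)) angles′))))
    -- Otherwise `a` would enumerate S with v added as well, giving it suc j elements, while `b`
    -- gives it one more.
    v∉S : v ∉ S
    v∉S v∈S = contradiction
      (trans (sym j≡j′) (↔⇒≡ (proj₁ (enumeration-permutation S∪v≐a Sv≐b (Acute-injective A) (Acute-injective B)))))
      (ℕₚ.<⇒≢ (ℕₚ.n<1+n (suc j′)))
      where
      S∪v≐a : S ∪ ｛ v ｝ ≐ Image a
      S∪v≐a = (λ { (inj₁ x∈S) → proj₁ S≐a x∈S ; (inj₂ refl) → proj₁ S≐a v∈S }) , inj₁ ∘ proj₂ S≐a
    cons-injective : ∀ {i m} → cons v a i ≡ cons v a m → i ≡ m
    cons-injective {zero} {zero} _ = refl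
    cons-injective {zero} {suc m} v≡am = contradiction (proj₂ S≐a (m , sym v≡am)) v∉S
    cons-injective {suc i} {zero} ai≡v = contradiction (proj₂ S≐a (i , ai≡v)) v∉S
    cons-injective {suc i} {suc m} ai≡am = cong suc (Acute-injective A ai≡am)
    matching : ∃ λ (π : Permutation (suc (suc j)) (suc (suc j′))) → ∀ i → cons v a i ≡ b (π ⟨$⟩ʳ i)
    matching = enumeration-permutation (Image-cons v S≐a) Sv≐b cons-injective (Acute-injective B)

-- Passing to the larger cube.

ι-++ : ∀ {n m} (s t : Cube n) (u w : Cube m) → ι (s ++ u) · ι (t ++ w) ≡ ι s · ι t + ι u · ι w
ι-++ [] [] u w = sym (+-identityˡ (ι u · ι w))
ι-++ (x ∷ s) (y ∷ t) u w = trans (cong (ι (x ∷ s) zero * ι (y ∷ t) zero +_) (ι-++ s t u w))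
  (lemma (ι (x ∷ s) zero * ι (y ∷ t) zero) (ι s · ι t) (ι u · ι w))
  where
  lemma : ∀ p q r → p + (q + r) ≡ p + q + r
  lemma = solve-∀ ℚ-ring

ι-replicate : ∀ {m} (w : Cube m) → ι (replicate m false) · ι w ≡ 0ℚ
ι-replicate {m} w = Σ-zero term
  where
  term : ∀ i → ι (replicate m false) i * ι w i ≡ 0ℚ
  term i rewrite lookup-replicate i false = *-zeroˡ (ι w i)

ι-facet : ∀ {n m} (s t : Cube n) (w : Cube m) → ι (s ++ replicate m false) · ι (t ++ w) ≡ ι s · ι t
ι-facet {m = m} s t w = trans (ι-++ s t (replicate m false) w) (trans (cong (ι s · ι t +_) (ι-replicate w)) (+-identityʳ (ι s · ι t)))

-- Heights over the small and the large cube are vectors of different lengths. Inner products with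
-- vertices can be compared, and x · x is the only term here that w affects.
η-formula : ∀ {N j} {a : Fin (suc j) → ℚ^ N} (A : Acute a) x →
  Acute.η A x ≡ x · x - Σℚ (λ i → Acute.coord A i x * (x · a i)) - γ A x
η-formula {a = a} A x = begin
  η x                                             ≡⟨ lemma (η x) (γ A x) ⟩
  η x + γ A x - γ A x                             ≡⟨ cong (_- γ A x) (height-self A x) ⟨
  height x · x - γ A x                            ≡⟨ cong (_- γ A x) (·-−ˡ x (foot x) x) ⟩
  x · x - foot x · x - γ A x
    ≡⟨ cong (λ z → x · x - z - γ A x) (trans (·-comm (foot x) x) (·-lin x (λ i → coord i x) a)) ⟩
  x · x - Σℚ (λ i → coord i x * (x · a i)) - γ A x ∎
  where
  open Acute A
  open ≡-Reasoning
  lemma : ∀ s t → s ≡ s + t - t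
  lemma = solve-∀ ℚ-ring

module Facet {n j} {S : Pred (Cube n) 0ℓ} {a : Fin (suc j) → Cube n} (S≐a : S ≐ Image a) (A : Acute (λ i → ι (a i))) (m : ℕ) where
  open Acute A

  a⁺ : Fin (suc j) → Cube (n ℕ.+ m)
  a⁺ i = a i ++ replicate m false

  embed≐a⁺ : embed m S ≐ Image a⁺
  embed≐a⁺ = forth , back
    where
    forth : embed m S ⊆ Image a⁺
    forth (s , s∈S , refl) with proj₁ S≐a s∈S
    ... | i , refl = i , refl
    back : Image a⁺ ⊆ embed m S
    back (i , refl) = a i , proj₂ S≐a (i , refl) , refl

  -- Reindexing along the identity leaves L and κ unchanged by computation.
  A⁺ : Acute (λ i → ι (a⁺ i))
  A⁺ = Acute-reindex idₚ (λ i l → ι-facet (a i) (a l) (replicate m false)) A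

  module A⁺ = Acute A⁺

  coord-facet : ∀ i v w → coord i (ι v) ≡ A⁺.coord i (ι (v ++ w))
  coord-facet i v w = cong (_+ κ i) (Σ-cong (λ l → cong (L i l *_) (sym (ι-facet (a l) v w))))

  η-facet : ∀ v w → η (ι v) + ι w · ι w ≡ A⁺.η (ι (v ++ w))
  η-facet v w = begin
    η (ι v) + ι w · ι w
      ≡⟨ cong (_+ ι w · ι w) (η-formula A (ι v)) ⟩
    ι v · ι v - Σℚ (λ i → coord i (ι v) * (ι v · ι (a i))) - γ A (ι v) + ι w · ι w
      ≡⟨ lemma (ι v · ι v) (Σℚ (λ i → coord i (ι v) * (ι v · ι (a i)))) (γ A (ι v)) (ι w · ι w) ⟩
    ι v · ι v + ι w · ι w - Σℚ (λ i → coord i (ι v) * (ι v · ι (a i))) - γ A (ι v)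
      ≡⟨ cong₂ (λ y z → y - Σℚ (λ i → coord i (ι v) * (ι v · ι (a i))) - z) (sym (ι-++ v v w w)) γ-facet ⟩
    ι (v ++ w) · ι (v ++ w) - Σℚ (λ i → coord i (ι v) * (ι v · ι (a i))) - γ A⁺ (ι (v ++ w))
      ≡⟨ cong (λ z → ι (v ++ w) · ι (v ++ w) - z - γ A⁺ (ι (v ++ w)))
           (Σ-cong (λ i → cong₂ _*_ (coord-facet i v w) (trans
              (·-comm (ι v) (ι (a i))) (trans (sym (ι-facet (a i) v w)) (·-comm (ι (a⁺ i)) (ι (v ++ w))))))) ⟩
    ι (v ++ w) · ι (v ++ w) - Σℚ (λ i → A⁺.coord i (ι (v ++ w)) * (ι (v ++ w) · ι (a⁺ i))) - γ A⁺ (ι (v ++ w))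
      ≡⟨ η-formula A⁺ (ι (v ++ w)) ⟨
    A⁺.η (ι (v ++ w)) ∎
    where
    open ≡-Reasoning
    lemma : ∀ s t u r → s - t - u + r ≡ s + r - t - u
    lemma = solve-∀ ℚ-ring
    γ-facet : γ A (ι v) ≡ γ A⁺ (ι (v ++ w))
    γ-facet = cong₂ _-_ (Σ-cong (λ i → cong (_* κ i) (sym (ι-facet (a i) v w))))
      (Σ-cong (λ i → cong (_* κ i) (sym (ι-facet (a i) (a zero) (replicate m false)))))

  𝒞-embed : 𝒞 (embed m S) ≐ cylinder m (𝒞 S)
  𝒞-embed = forth , back
    where
    forth : 𝒞 (embed m S) ⊆ cylinder m (𝒞 S)
    forth {x} x∈𝒞 with splitAt n x
    ... | v , w , refl = v , w , coord-positive⇒𝒞 S≐a A v (λ i →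
      subst (0ℚ <_) (sym (coord-facet i v w)) (𝒞⇒coord-positive embed≐a⁺ A⁺ (v ++ w) x∈𝒞 i)) , refl
    back : cylinder m (𝒞 S) ⊆ 𝒞 (embed m S)
    back (v , w , v∈𝒞 , refl) = coord-positive⇒𝒞 embed≐a⁺ A⁺ (v ++ w) (λ i →
      subst (0ℚ <_) (coord-facet i v w) (𝒞⇒coord-positive S≐a A v v∈𝒞 i))

  private
    Extends-cong : ∀ {k} {L : Matrix k k} {β β′ : Fin k → ℚ} {η η′ : ℚ} →
      (∀ i → β i ≡ β′ i) → η ≡ η′ → Extends L β η → Extends L β′ η′
    Extends-cong {L = L} {η = η} β≡β′ refl extends = record
      { β-pos = λ i → subst (0ℚ <_) (β≡β′ i) (β-pos i)
      ; η-pos = η-pos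
      ; gap   = λ i m i≢m → subst (_< 0ℚ) (cong₂ (λ y z → L i m * η + y * z) (β≡β′ i) (β≡β′ m)) (gap i m i≢m)
      }
      where open Extends extends

  𝒜-embed : ∀ v w → Extends L (λ i → coord i (ι v)) (η (ι v) + ι w · ι w) ⇔ (v ++ w ∈ 𝒜 (embed m S))
  𝒜-embed v w = mk⇔
    (λ extends → Extends⇒𝒜 embed≐a⁺ A⁺ (Extends-cong (λ i → coord-facet i v w) (η-facet v w) extends))
    (λ v++w∈𝒜 → Extends-cong (λ i → sym (coord-facet i v w)) (sym (η-facet v w)) (𝒜⇒Extends embed≐a⁺ A⁺ v++w∈𝒜))

-- Monotonicity in η and the least threshold.

gap-mono : ∀ {l c η η′} → l < 0ℚ → η ≤ℚ η′ → l * η + c < 0ℚ → l * η′ + c < 0ℚ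
gap-mono {l} {c} l<0 η≤η′ = ≤-<-trans (+-monoˡ-≤ c (*-monoˡ-≤-nonPos l {{nonPositive (<⇒≤ l<0)}} η≤η′))

Extends-mono : ∀ {k} {L : Matrix k k} {β : Fin k → ℚ} {η η′ : ℚ} → (∀ i m → i ≢ m → L i m < 0ℚ) →
  η ≤ℚ η′ → Extends L β η → Extends L β η′
Extends-mono L-neg η≤η′ extends = record
  { β-pos = β-pos
  ; η-pos = <-≤-trans η-pos η≤η′
  ; gap   = λ i m i≢m → gap-mono (L-neg i m i≢m) η≤η′ (gap i m i≢m)
  }
  where open Extends extends

Extends? : ∀ {k} (L : Matrix k k) (β : Fin k → ℚ) (η : ℚ) → Dec (Extends L β η)
Extends? L β η = map′
  (λ (β-pos , η-pos , gap) → record { β-pos = β-pos ; η-pos = η-pos ; gap = gap })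
  (λ extends → let open Extends extends in β-pos , η-pos , gap)
  (all? (λ i → 0ℚ <? β i) ×-dec 0ℚ <? η ×-dec
   all? λ i → all? λ m → ¬? (i ≟ m) →-dec (L i m * η + β i * β m <? 0ℚ))

fromℕ : ℕ → ℚ
fromℕ r = ℤ.+ r / 1

-- The normalisation behind `_/_` hides numerator and denominator; this form exposes them to the
-- order on fractions.
fromℕ-mkℚ : ∀ r → fromℕ r ≡ mkℚ (ℤ.+ r) 0 (Coprimality.sym (Coprimality.1-coprimeTo r))
fromℕ-mkℚ r = normalize-coprime (Coprimality.sym (Coprimality.1-coprimeTo r))

fromℕ-mono : ∀ {r s} → r ≤ s → fromℕ r ≤ℚ fromℕ s
fromℕ-mono {r} {s} r≤s = subst₂ _≤ℚ_ (sym (fromℕ-mkℚ r)) (sym (fromℕ-mkℚ s))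
  (*≤* (ℤₚ.*-monoʳ-≤-nonNeg (ℤ.+ 1) (ℤ.+≤+ r≤s)))

fromℕ-cancel : ∀ {r s} → fromℕ r ≤ℚ fromℕ s → r ≤ s
fromℕ-cancel {r} {s} r≤s = ℤₚ.drop‿+≤+ (subst₂ ℤ._≤_ (ℤₚ.*-identityʳ (ℤ.+ r)) (ℤₚ.*-identityʳ (ℤ.+ s))
  (drop-*≤* (subst₂ _≤ℚ_ (fromℕ-mkℚ r) (fromℕ-mkℚ s) r≤s)))

fromℕ-suc : ∀ r → fromℕ (suc r) ≡ 1ℚ + fromℕ r
fromℕ-suc r = sym (trans (cong (1ℚ +_) (fromℕ-mkℚ r)) (cong (λ z → (ℤ.+ 1 ℤ.+ z) / 1) (ℤₚ.*-identityʳ (ℤ.+ r))))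

fromℕ-unbounded : ∀ p → ∃ λ r → p < fromℕ r
fromℕ-unbounded p@(mkℚ n d c) = suc ℤ.∣ n ∣ , ≤-<-trans p≤
  (subst₂ _<_ (+-identityˡ (fromℕ ℤ.∣ n ∣)) (sym (fromℕ-suc ℤ.∣ n ∣)) (+-monoˡ-< (fromℕ ℤ.∣ n ∣) 0<1))
  where
  i≤∣i∣ : ∀ i → i ℤ.≤ ℤ.+ ℤ.∣ i ∣
  i≤∣i∣ (ℤ.+ _) = ℤₚ.≤-refl
  i≤∣i∣ ℤ.-[1+ _ ] = ℤ.-≤+
  p≤ : p ≤ℚ fromℕ ℤ.∣ n ∣
  p≤ = subst (p ≤ℚ_) (sym (fromℕ-mkℚ ℤ.∣ n ∣)) (*≤* (ℤₚ.≤-trans (subst (ℤ._≤ ℤ.+ ℤ.∣ n ∣) (sym (ℤₚ.*-identityʳ n)) (i≤∣i∣ n))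
    (subst (ℤ.+ ℤ.∣ n ∣ ℤ.≤_) (ℤₚ.pos-* ℤ.∣ n ∣ (suc d)) (ℤ.+≤+ (ℕₚ.m≤m*n ℤ.∣ n ∣ (suc d))))))

-- Any natural number above c / (- l) works.
gap-eventually : ∀ {l} c → l < 0ℚ → ∃ λ r → l * fromℕ r + c < 0ℚ
gap-eventually {l} c l<0 = proj₁ large , 0<-⇒< (subst (0ℚ <_) identity (*-pos (<⇒0<- (proj₂ large)) 0<-l))
  where
  open ≡-Reasoning
  0<-l : 0ℚ < - l
  0<-l = neg-antimono-< l<0
  s : ℚ
  s = proj₁ (inverse 0<-l)
  large : ∃ λ r → c * s < fromℕ r
  large = fromℕ-unbounded (c * s)
  r : ℚ
  r = fromℕ (proj₁ large)
  lemma : ∀ r c s l → (r - c * s) * - l ≡ 0ℚ - (l * r + c * (s * - l))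
  lemma = solve-∀ ℚ-ring
  identity : (r - c * s) * - l ≡ 0ℚ - (l * r + c)
  identity = trans (lemma r c s l) (cong (λ z → 0ℚ - (l * r + z))
    (trans (cong (c *_) (proj₂ (proj₂ (inverse 0<-l)))) (*-identityʳ c)))

eventually-all : ∀ {k} {P : Fin k → ℕ → Set} → (∀ i {r s} → r ≤ s → P i r → P i s) →
  (∀ i → ∃ (P i)) → ∃ λ r → ∀ i → P i r
eventually-all {zero} mono P-r = 0 , λ ()
eventually-all {suc k} mono P-r with P-r zero | eventually-all (λ i → mono (suc i)) (λ i → P-r (suc i))
... | r , P₀r | s , Ps = r ⊔ s , λ where
  zero    → mono zero (ℕₚ.m≤m⊔n r s) P₀r
  (suc i) → mono (suc i) (ℕₚ.m≤n⊔m r s) (Ps i)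

Extends-eventually : ∀ {k} {L : Matrix k k} {β : Fin k → ℚ} {η : ℚ} → (∀ i m → i ≢ m → L i m < 0ℚ) →
  (∀ i → 0ℚ < β i) → 0ℚ ≤ℚ η → ∃ λ r → Extends L β (η + fromℕ r)
-- The successor keeps η + r positive when η is zero, as happens if S consists of v alone.
Extends-eventually {k} {L} {β} {η} L-neg β-pos 0≤η = suc r , record
  { β-pos = β-pos
  ; η-pos = <-≤-trans (subst (0ℚ <_) (sym (fromℕ-suc r)) (0<1+ (fromℕ-mono {0} {r} z≤n))) suc-r≤
  ; gap   = λ i m i≢m → gap-mono (L-neg i m i≢m) (≤-trans (fromℕ-mono (ℕₚ.n≤1+n r)) suc-r≤) (proj₂ gaps i m i≢m)
  }
  where
  Gap : Fin k → Fin k → ℕ → Set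
  Gap i m r = i ≢ m → L i m * fromℕ r + β i * β m < 0ℚ
  Gap-mono : ∀ i m {r s} → r ≤ s → Gap i m r → Gap i m s
  Gap-mono i m r≤s g i≢m = gap-mono (L-neg i m i≢m) (fromℕ-mono r≤s) (g i≢m)
  Gap-eventually : ∀ i m → ∃ (Gap i m)
  Gap-eventually i m with i ≟ m
  ... | yes i≡m = 0 , λ i≢m → contradiction i≡m i≢m
  ... | no i≢m = map₂ (λ g _ → g) (gap-eventually (β i * β m) (L-neg i m i≢m))
  gaps : ∃ λ r → ∀ i m → Gap i m r
  gaps = eventually-all (λ i r≤s g m → Gap-mono i m r≤s (g m)) (λ i → eventually-all (Gap-mono i) (Gap-eventually i))
  r : ℕ
  r = proj₁ gaps
  suc-r≤ : fromℕ (suc r) ≤ℚ η + fromℕ (suc r)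
  suc-r≤ = subst (_≤ℚ η + fromℕ (suc r)) (+-identityˡ (fromℕ (suc r))) (+-monoˡ-≤ (fromℕ (suc r)) 0≤η)

-- If Q 0 fails, the predicate is shifted by one and the witness drops by one; decidability of Q
-- settles which case occurs, and upward closure gives all larger values.
threshold : ∀ {Q : ℕ → Set} → (∀ r → Dec (Q r)) → (∀ {r s} → r ≤ s → Q r → Q s) → ∀ r → Q r →
  ∃ λ ℓ → ∀ r → ℓ ≤ r ⇔ Q r
threshold Q? mono zero Q0 = 0 , λ r → mk⇔ (λ _ → mono z≤n Q0) (λ _ → z≤n)
threshold Q? mono (suc r) Qr with Q? 0
... | yes Q0 = 0 , λ r → mk⇔ (λ _ → mono z≤n Q0) (λ _ → z≤n)
... | no ¬Q0 with threshold (Q? ∘ suc) (mono ∘ s≤s) r Qr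
... | ℓ , ℓ≤⇔Q = suc ℓ , λ where
  zero    → mk⇔ (λ ()) (λ Q0 → contradiction Q0 ¬Q0)
  (suc s) → mk⇔ (λ { (s≤s ℓ≤s) → Equivalence.to (ℓ≤⇔Q s) ℓ≤s }) (s≤s ∘ Equivalence.from (ℓ≤⇔Q s))

ones : ∀ {m} → Cube m → ℕ
ones [] = 0
ones (true ∷ w) = suc (ones w)
ones (false ∷ w) = ones w

ι-ones : ∀ {m} (w : Cube m) → ι w · ι w ≡ fromℕ (ones w)
ι-ones [] = refl
ι-ones (true ∷ w) = trans (cong (1ℚ +_) (ι-ones w)) (sym (fromℕ-suc (ones w)))
ι-ones (false ∷ w) = trans (+-identityˡ (ι w · ι w)) (ι-ones w)

theorem5p11 : ∀ (n j : ℕ) (S : Pred (Cube n) 0ℓ) → IsAcuteSimplex j S → suc j ≤ n →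
    (∀ m → 1 ≤ m →
    IsAcuteSimplex j (embed m S) ×
    (𝒞 (embed m S) ≐ cylinder m (𝒞 S)) ×
    (𝒜 (embed m S) ⊇ cylinder m (𝒜 S))) ×
    (∀ v → v ∈ 𝒞 S →
    ∃ λ (ℓ : ℤ) → ∃ λ (M : ℕ) → ∀ m → M ≤ m → ∀ (w : Cube m) →
    (ℓ / 1 ≤ℚ ι w · ι w) ⇔ (v ++ w ∈ 𝒜 (embed m S)))
theorem5p11 n j S (a , S≐a , _ , angles) _ = facet , extensions
  where
  A : Acute (λ i → ι (a i))
  A = HasAcuteAngles⇒Acute (λ i → ι (a i)) angles
  open Acute A
  facet : ∀ m → 1 ≤ m →
    IsAcuteSimplex j (embed m S) × (𝒞 (embed m S) ≐ cylinder m (𝒞 S)) × (𝒜 (embed m S) ⊇ cylinder m (𝒜 S))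
  facet m _ = Acute⇒IsAcuteSimplex a⁺ embed≐a⁺ A⁺ , 𝒞-embed , 𝒜-cylinder
    where
    open Facet S≐a A m
    𝒜-cylinder : cylinder m (𝒜 S) ⊆ 𝒜 (embed m S)
    𝒜-cylinder (v , w , v∈𝒜 , refl) = Equivalence.to (𝒜-embed v w)
      (Extends-mono L-neg (subst (_≤ℚ η (ι v) + ι w · ι w) (+-identityʳ (η (ι v))) (+-monoʳ-≤ (η (ι v)) (·-nonneg (ι w))))
        (𝒜⇒Extends S≐a A v∈𝒜))
  extensions : ∀ v → v ∈ 𝒞 S → ∃ λ (ℓ : ℤ) → ∃ λ (M : ℕ) → ∀ m → M ≤ m → ∀ (w : Cube m) →
    (ℓ / 1 ≤ℚ ι w · ι w) ⇔ (v ++ w ∈ 𝒜 (embed m S))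
  -- `least` does not depend on m, so `M` can be 0; if m is below ℓ, both sides fail for every w.
  extensions v v∈𝒞 = ℤ.+ proj₁ least , 0 , λ m _ w → let open Facet S≐a A m in mk⇔
    (λ ℓ≤w·w → Equivalence.to (𝒜-embed v w) (subst (λ z → Extends L β (η (ι v) + z)) (sym (ι-ones w))
      (Equivalence.to (proj₂ least (ones w)) (fromℕ-cancel (subst (fromℕ (proj₁ least) ≤ℚ_) (ι-ones w) ℓ≤w·w)))))
    (λ v++w∈𝒜 → subst (fromℕ (proj₁ least) ≤ℚ_) (sym (ι-ones w)) (fromℕ-mono (Equivalence.from (proj₂ least (ones w))
      (subst (λ z → Extends L β (η (ι v) + z)) (ι-ones w) (Equivalence.from (𝒜-embed v w) v++w∈𝒜)))))
    where
    β : Fin (suc j) → ℚ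
    β i = coord i (ι v)
    least : ∃ λ ℓ → ∀ r → ℓ ≤ r ⇔ Extends L β (η (ι v) + fromℕ r)
    least = threshold (λ r → Extends? L β (η (ι v) + fromℕ r))
      (λ r≤s → Extends-mono L-neg (+-monoʳ-≤ (η (ι v)) (fromℕ-mono r≤s))) (proj₁ eventual) (proj₂ eventual)
      where
      eventual : ∃ λ r → Extends L β (η (ι v) + fromℕ r)
      eventual = Extends-eventually L-neg (𝒞⇒coord-positive S≐a A v v∈𝒞) (·-nonneg (height (ι v)))
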